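{- For every integer $i\ge 0$, $J(3i+2,\,2i+1)$ is positive and equals the Catalan number $C_i=\frac{1}{i+1}\binom{2i}{i}$.
   Context: Let $\pi=\pi_1\cdots\pi_n$ be a permutation of $[n]$. An entry $\pi_i$ is a left-to-right minimum if $\pi_j>\pi_i$ for all $j<i$. Let the left-to-right minima of $\pi$ be at positions $k_1<k_2<\dots<k_a$ (so $\pi_{k_1}>\dots>\pi_{k_a}$), and set $\pi_{k_0}:=n+1$ and $k_{a+1}:=n+1$. The staircase grid $B_a$ consists of the boxes $(i,j)$ with $1\le i\le j\le a$, where $i$ is the row index counted from the top and $j$ is the column index counted from the left. The staircase encoding of $\pi$ fills box $(i,j)$ of $B_a$ with the number of indices $p$ with $k_j<p<k_{j+1}$ and $\pi_{k_i}<\pi_p<\pi_{k_{i-1}}$. A permutation $\pi$ contains $132$ if there are indices $p<q<r$ with $\pi_p<\pi_r<\pi_q$, and avoids $132$ otherwise. For integers $\ell\ge1$, $k\ge0$, let $J(\ell,k)$ denote the number of $132$-avoiding permutations of $[\ell]$ whose staircase encoding has exactly $k$ nonzero boxes. -}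

module Defs where

open import Data.Nat using (ℕ; zero; suc; _+_; _*_; _<ᵇ_; _≡ᵇ_; pred)
open import Data.Nat.Combinatorics using (_C_)
open import Data.Bool using (Bool; true; false; _∧_; _∨_; not; if_then_else_)
open import Data.List using (List; []; _∷_; map; filter; length; upTo; concatMap)
open import Data.Bool.ListAction using (all; any)
open import Data.Product using (_×_; _,_; proj₁; proj₂)
open import Data.Nat.DivMod using (_/_)
open import Relation.Nullary.Decidable using (does)
open import Data.Bool.Properties using (T?)

-- Conventions: a permutation of [n] is a list of length n of the values 1..n,
-- each occurring exactly once.  Positions are 0-indexed (0..n-1).

words : ℕ → ℕ → List (List ℕ)
words zero    n = [] ∷ []
words (suc m) n = concatMap (λ w → map (λ x → suc x ∷ w) (upTo n)) (words m n)

distinct : List ℕ → Bool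
distinct []       = true
distinct (x ∷ xs) = not (any (λ y → x ≡ᵇ y) xs) ∧ distinct xs

perms : ℕ → List (List ℕ)
perms n = filter (λ w → T? (distinct w)) (words n n)

-- entry at position p (0-indexed); default 0 outside the range
at : List ℕ → ℕ → ℕ
at []       _       = 0
at (x ∷ xs) zero    = x
at (x ∷ xs) (suc p) = at xs p

contains132 : List ℕ → Bool
contains132 π =
  any (λ r → any (λ q → any (λ p →
        (at π p <ᵇ at π r) ∧ (at π r <ᵇ at π q)) (upTo q)) (upTo r))
      (upTo (length π))

avoids132 : List ℕ → Bool
avoids132 π = not (contains132 π)

ltrMinPos : List ℕ → List ℕ
ltrMinPos π = filter (λ i → T? (all (λ j → at π i <ᵇ at π j) (upTo i)))
                     (upTo (length π))

-- k_t for t = 1..a (and k_{a+1} := n, the 0-indexed analogue of n+1)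
kPos : List ℕ → ℕ → ℕ
kPos π t = go (ltrMinPos π) t
  where
  go : List ℕ → ℕ → ℕ
  go []       _             = length π
  go (k ∷ ks) zero          = length π   -- t = 0 never used for positions
  go (k ∷ ks) (suc zero)    = k
  go (k ∷ ks) (suc (suc t)) = go ks (suc t)

-- π_{k_t} for t = 1..a, with π_{k_0} := n+1
kVal : List ℕ → ℕ → ℕ
kVal π zero    = suc (length π)
kVal π (suc t) = at π (kPos π (suc t))

-- filling of box (i,j) of the staircase grid B_a:
-- #{ p : k_j < p < k_{j+1} and π_{k_i} < π_p < π_{k_{i-1}} }
box : List ℕ → ℕ → ℕ → ℕ
box π i j = length (filter
  (λ p → T? ((kPos π j <ᵇ p) ∧ (p <ᵇ kPos π (suc j)) ∧
             (kVal π i <ᵇ at π p) ∧ (at π p <ᵇ kVal π (pred i))))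
  (upTo (length π)))

boxes : ℕ → List (ℕ × ℕ)
boxes a = concatMap (λ j → map (λ i → (suc i , suc j)) (upTo (suc j))) (upTo a)

nonzeroBoxes : List ℕ → ℕ
nonzeroBoxes π = length (filter (λ b → T? (0 <ᵇ box π (proj₁ b) (proj₂ b)))
                                (boxes (length (ltrMinPos π))))

J : ℕ → ℕ → ℕ
J ℓ k = length (filter (λ π → T? (avoids132 π ∧ (nonzeroBoxes π ≡ᵇ k))) (perms ℓ))

catalan : ℕ → ℕ
catalan i = ((2 * i) C i) / suc i

{-# OPTIONS --safe #-}

-- A 132-avoider is L n R with every entry of L above every entry of R, so
-- 132-avoiders are binary trees.  Its left-to-right minima are those of L n
-- followed by those of R, and its nonzero boxes are those of L n and those of R.
-- Appending the maximum n to a nonempty L fills the top box of the last column,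
-- which is new unless L already ended with its maximum (and |L| > 1).  Hence a
-- nonempty 132-avoider of size s with a minima and k nonzero boxes satisfies
-- k + a ≤ s and k + 1 ≤ 2a.  For s = 3i + 2 and k = 2i + 1 both bounds are
-- attained, and the trees attaining both are the images of the binary trees with
-- i nodes under an explicit injection.  These are counted through forests, whose
-- numbers satisfy the ballot recursion.

module Submission where

open import Defs
open import Data.Nat using (ℕ; zero; suc; pred; _+_; _*_; _∸_; _≤_; _<_; s≤s; z≤n; _<ᵇ_; _≡ᵇ_; >-nonZero)
open import Data.Nat.Combinatorics using (_C_; nCk≡nC[n∸k]; nC1≡n; k>n⇒nCk≡0; nCk+nC[k+1]≡[n+1]C[k+1])
open import Data.Nat.DivMod using (_/_; m*n/n≡m)
open import Data.Nat.Properties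
open import Data.Nat.Tactic.RingSolver using (solve-∀)
open import Data.Bool using (Bool; true; false; T; not; _∧_; if_then_else_)
open import Data.Bool.ListAction using (all; any)
open import Data.Bool.Properties using (T?)
open import Data.List using (List; []; _∷_; [_]; map; _++_; length; upTo; applyUpTo; filter)
open import Data.List.Properties
  using (length-map; length-++; length-upTo; ++-assoc; ++-identityʳ; ∷-injective; ∷-injectiveˡ; ∷-injectiveʳ;
         filter-++; filter-reject; map-upTo)
open import Data.List.Membership.DecPropositional _≟_ using (_∈?_)
open import Data.List.Membership.Propositional using (_∈_; _∉_; find; lose)
open import Data.List.Membership.Propositional.Properties
open import Data.List.Relation.Binary.Disjoint.Propositional using (Disjoint)
open import Data.List.Relation.Binary.Subset.Propositional using (_⊆_)
open import Data.List.Relation.Unary.All using ([]; _∷_; lookup; tabulate)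
import Data.List.Relation.Unary.All.Properties as All
open import Data.List.Relation.Unary.AllPairs as AllPairs using ([]; _∷_)
import Data.List.Relation.Unary.AllPairs.Properties as AllPairs
open import Data.List.Relation.Unary.Any using (here; there)
open import Data.List.Relation.Unary.Any.Properties using (any⁺; any⁻)
open import Data.List.Relation.Unary.Unique.Propositional using (Unique)
import Data.List.Relation.Unary.Unique.Propositional.Properties as Unique
open import Data.Vec using (Vec; []; _∷_)
open import Data.Product using (_×_; _,_; proj₁; proj₂; ∃-syntax)
open import Data.Sum using (_⊎_; inj₁; inj₂)
open import Data.Empty using (⊥; ⊥-elim)
open import Data.Unit using (⊤; tt)
open import Function using (_∘_)
open import Relation.Binary.Definitions using (tri<; tri≈; tri>)
open import Relation.Binary.PropositionalEquality hiding ([_]; J)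
open import Relation.Nullary using (¬_; yes; no; contradiction)

-- Binary trees and Catalan numbers

-- The bound k + 1 ≤ 2a is not inductive by itself: appending the maximum to L with nothing after it
-- may add a box but adds no minimum. The induction therefore carries k + 2 ≤ 2a for nonempty trees
-- whose last column has an empty top box. A new box arises exactly over such an L, and the spare
-- unit pays for it. Eliminating a from the two bounds leaves 3k + 1 ≤ 2s. For k = 2i + 1 and s = 3i
-- + 2 both sides are 6i + 4, so neither bound has any slack. With slack kept as explicit natural
-- numbers, the equality case is read off from the steps that create none: a single entry, a maximum
-- appended to a slack-free tree with empty top box, and a node joining such a tree on its left to a
-- slack-free tree with filled top box on its right. The last step is a free binary operation, which
-- is where the Catalan numbers enter. The convolution of Catalan numbers does not lead directly to
-- the closed formula. Counting tuples of trees makes the recursion linear, so that Pascal's rule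
-- applies.

data Tree : Set where
  leaf : Tree
  node : (l r : Tree) → Tree

size : Tree → ℕ
size leaf       = 0
size (node l r) = suc (size l + size r)

total : ∀ {s} → Vec Tree s → ℕ
total []       = 0
total (t ∷ ts) = size t + total ts

graft : ∀ {s} → Vec Tree (2 + s) → Vec Tree (1 + s)
graft (l ∷ r ∷ ts) = node l r ∷ ts

-- If the first tree of a forest is a node, removing its root leaves one more tree and one node
-- fewer. The recursion thus descends in `i`, or keeps `i` and descends in `s`.
forests : (s i : ℕ) → List (Vec Tree s)
grafted : (s i : ℕ) → List (Vec Tree (suc s))
forests zero    zero    = [] ∷ []
forests zero    (suc i) = []
forests (suc s) i       = map (leaf ∷_) (forests s i) ++ grafted s i
grafted s zero    = []
grafted s (suc i) = map graft (forests (2 + s) i)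

∈-forests⁻ : ∀ s i {ts} → ts ∈ forests s i → total ts ≡ i
∈-grafted⁻ : ∀ s i {ts} → ts ∈ grafted s i → total ts ≡ i
∈-forests⁻ zero zero {[]} _ = refl
∈-forests⁻ (suc s) i p with ∈-++⁻ (map (leaf ∷_) (forests s i)) p
... | inj₂ q = ∈-grafted⁻ s i q
... | inj₁ q with ∈-map⁻ (leaf ∷_) q
...   | _ , q′ , refl = ∈-forests⁻ s i q′
∈-grafted⁻ s (suc i) p with ∈-map⁻ graft p
... | l ∷ r ∷ ts , q , refl =
  cong suc (trans (+-assoc (size l) (size r) (total ts)) (∈-forests⁻ (2 + s) i q))

∈-forests⁺ : ∀ s i (ts : Vec Tree s) → total ts ≡ i → ts ∈ forests s i
∈-forests⁺ zero    zero    []              _  = here refl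
∈-forests⁺ (suc s) i       (leaf ∷ ts)     eq =
  ∈-++⁺ˡ (∈-map⁺ (leaf ∷_) (∈-forests⁺ s i ts eq))
∈-forests⁺ (suc s) (suc i) (node l r ∷ ts) eq =
  ∈-++⁺ʳ (map (leaf ∷_) (forests s (suc i))) (∈-map⁺ graft (∈-forests⁺ (2 + s) i (l ∷ r ∷ ts)
    (trans (sym (+-assoc (size l) (size r) (total ts))) (suc-injective eq))))

forests-unique : ∀ s i → Unique (forests s i)
grafted-unique : ∀ s i → Unique (grafted s i)
forests-unique zero    zero    = [] ∷ []
forests-unique zero    (suc i) = []
forests-unique (suc s) i       =
  Unique.++⁺ (Unique.map⁺ (λ { refl → refl }) (forests-unique s i)) (grafted-unique s i)
    λ (p , q) → disjoint i p q
  where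
  disjoint : ∀ i {ts} → ts ∈ map (leaf ∷_) (forests s i) → ts ∈ grafted s i → _
  disjoint (suc i) p q with ∈-map⁻ (leaf ∷_) p | ∈-map⁻ graft q
  ... | _ , _ , refl | _ ∷ _ ∷ _ , _ , ()
grafted-unique s zero    = []
grafted-unique s (suc i) = Unique.map⁺ graft-injective (forests-unique (2 + s) i)
  where
  graft-injective : ∀ {ts us : Vec Tree (2 + s)} → graft ts ≡ graft us → ts ≡ us
  graft-injective {_ ∷ _ ∷ _} {_ ∷ _ ∷ _} refl = refl

-- Ballot numbers and their closed form

length-forests : ∀ s i → length (forests (suc s) i) ≡ length (forests s i) + length (grafted s i)
length-forests s i = trans (length-++ (map (leaf ∷_) (forests s i)))
  (cong (_+ length (grafted s i)) (length-map (leaf ∷_) (forests s i)))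

length-forests-0 : ∀ s → length (forests s 0) ≡ 1
length-forests-0 zero    = refl
length-forests-0 (suc s) = trans (length-forests s 0) (trans (+-identityʳ _) (length-forests-0 s))

-- The forest recursion and Pascal's rule match term by term, so the count is a difference of
-- neighbouring binomial coefficients; the additive form avoids truncated subtraction. At `s = 0`
-- there is no forest, and the two coefficients agree by symmetry.
ballot : ∀ s i → let n = suc (2 * i + s) in length (forests s (suc i)) + n C i ≡ n C (suc i)
ballot zero i = trans (nCk≡nC[n∸k] i≤n) (cong (suc (2 * i + 0) C_) n∸i)
  where
  n≡ : ∀ i → suc (2 * i + 0) ≡ i + suc i
  n≡ = solve-∀
  i≤n : i ≤ suc (2 * i + 0)
  i≤n = subst (i ≤_) (sym (n≡ i)) (m≤m+n i (suc i))
  n∸i : suc (2 * i + 0) ∸ i ≡ suc i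
  n∸i = trans (cong (_∸ i) (n≡ i)) (m+n∸m≡n i (suc i))
-- A coefficient with lower index -1 would be needed here; instead the only grafted forest, one node
-- with two leaves in front of leaves, is counted directly.
ballot (suc s) zero = begin
  length (forests (suc s) 1) + 1  ≡⟨ cong (_+ 1) (length-forests s 1) ⟩
  f + length (grafted s 1) + 1
    ≡⟨ cong (λ g → f + g + 1) (trans (length-map graft (forests (2 + s) 0)) (length-forests-0 (2 + s))) ⟩
  f + 1 + 1                       ≡⟨ cong (_+ 1) (ballot s 0) ⟩
  suc s C 1 + 1                   ≡⟨ +-comm (suc s C 1) 1 ⟩
  suc s C 0 + suc s C 1           ≡⟨ nCk+nC[k+1]≡[n+1]C[k+1] (suc s) 0 ⟩
  suc (suc s) C 1                 ∎
  where
  open ≡-Reasoning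
  f = length (forests s 1)
ballot (suc s) (suc i) = begin
  length (forests (suc s) (2 + i)) + suc m C suc i
    ≡⟨ cong₂ _+_ (trans (length-forests s (2 + i)) (cong (f +_) (length-map graft (forests (2 + s) (suc i)))))
                 (sym (nCk+nC[k+1]≡[n+1]C[k+1] m i)) ⟩
  (f + g) + (m C i + m C suc i)
    ≡⟨ shuffle f g (m C i) (m C suc i) ⟩
  (g + m C i) + (f + m C suc i)
    ≡⟨ cong₂ _+_ (subst (λ n → g + n C i ≡ n C suc i) (m₁ i s) (ballot (2 + s) i))
                 (subst (λ n → f + n C suc i ≡ n C (2 + i)) (m₂ i s) (ballot s (suc i))) ⟩
  m C suc i + m C (2 + i)
    ≡⟨ nCk+nC[k+1]≡[n+1]C[k+1] m (suc i) ⟩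
  suc m C (2 + i) ∎
  where
  open ≡-Reasoning
  f = length (forests s (2 + i))
  g = length (forests (2 + s) (suc i))
  m = 2 * suc i + suc s
  shuffle : ∀ a b c d → (a + b) + (c + d) ≡ (b + c) + (a + d)
  shuffle = solve-∀
  m₁ : ∀ i s → suc (2 * i + (2 + s)) ≡ 2 * suc i + suc s
  m₁ = solve-∀
  m₂ : ∀ i s → suc (2 * suc i + s) ≡ 2 * suc i + suc s
  m₂ = solve-∀

[k+1]*nC[k+1]≡d*nCk : ∀ k d → suc k * ((k + d) C suc k) ≡ d * ((k + d) C k)
[k+1]*nC[k+1]≡d*nCk zero    d       = trans (+-identityʳ _) (trans (nC1≡n d) (sym (*-identityʳ d)))
[k+1]*nC[k+1]≡d*nCk (suc k) zero    rewrite k>n⇒nCk≡0 (s≤s (≤-reflexive (cong suc (+-identityʳ k)))) = *-zeroʳ k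
[k+1]*nC[k+1]≡d*nCk (suc k) (suc d) = begin
  (2 + k) * (suc n C (2 + k))           ≡⟨ cong ((2 + k) *_) (nCk+nC[k+1]≡[n+1]C[k+1] n (suc k)) ⟨
  (2 + k) * (b + c)                     ≡⟨ e₁ k b c ⟩
  (suc k * b + b) + (2 + k) * c         ≡⟨ cong₂ (λ x y → (x + b) + y) ([k+1]*nC[k+1]≡d*nCk k (suc d))
                                             (subst (λ n → (2 + k) * (n C (2 + k)) ≡ d * (n C suc k)) (sym (+-suc k d))
                                               ([k+1]*nC[k+1]≡d*nCk (suc k) d)) ⟩
  (suc d * a + b) + d * b               ≡⟨ e₂ d a b ⟩
  suc d * (a + b)                       ≡⟨ cong (suc d *_) (nCk+nC[k+1]≡[n+1]C[k+1] n k) ⟩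
  suc d * (suc n C suc k)               ∎
  where
  open ≡-Reasoning
  n = k + suc d
  a = n C k
  b = n C suc k
  c = n C (2 + k)
  e₁ : ∀ k b c → (2 + k) * (b + c) ≡ (suc k * b + b) + (2 + k) * c
  e₁ = solve-∀
  e₂ : ∀ d a b → (suc d * a + b) + d * b ≡ suc d * (a + b)
  e₂ = solve-∀

-- `ballot` with one tree gives `f + a ≡ b`, and the absorption identity expresses `a` through `b`.
-- Together they show that the division in `catalan` is exact.
length-forests-1 : ∀ i → length (forests 1 i) ≡ catalan i
length-forests-1 zero    = refl
length-forests-1 (suc i) = begin
  f                            ≡⟨ m*n/n≡m f (2 + i) ⟨
  (f * (2 + i)) / (2 + i)      ≡⟨ cong (_/ (2 + i)) f*[2+i] ⟩
  (n C suc i) / (2 + i)        ∎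
  where
  open ≡-Reasoning
  f = length (forests 1 (suc i))
  n = 2 * suc i
  a = n C i
  b = n C suc i
  n≡₁ : ∀ i → suc (2 * i + 1) ≡ 2 * suc i
  n≡₁ = solve-∀
  n≡₂ : ∀ i → i + (2 + i) ≡ 2 * suc i
  n≡₂ = solve-∀
  f+a : f + a ≡ b
  f+a = subst (λ n → f + n C i ≡ n C suc i) (n≡₁ i) (ballot 1 i)
  absorb : suc i * b ≡ (2 + i) * a
  absorb = subst (λ n → suc i * (n C suc i) ≡ (2 + i) * (n C i)) (n≡₂ i) ([k+1]*nC[k+1]≡d*nCk i (2 + i))
  f*[2+i] : f * (2 + i) ≡ b
  f*[2+i] = +-cancelʳ-≡ (suc i * b) _ _ (begin
    f * (2 + i) + suc i * b    ≡⟨ cong (f * (2 + i) +_) absorb ⟩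
    f * (2 + i) + (2 + i) * a  ≡⟨ e f i a ⟩
    (2 + i) * (f + a)          ≡⟨ cong ((2 + i) *_) f+a ⟩
    b + suc i * b              ∎)
    where
    e : ∀ f i a → f * (2 + i) + (2 + i) * a ≡ (2 + i) * (f + a)
    e = solve-∀

-- 132-avoiders as binary trees

module _ {A : Set} where

  length-⊆ : {xs ys : List A} → Unique xs → xs ⊆ ys → length xs ≤ length ys
  length-⊆ []             _     = z≤n
  length-⊆ {x ∷ xs} (x≢xs ∷ xs!) xs⊆ys with ∈-∃++ (xs⊆ys (here refl))
  ... | as , bs , refl = begin
    suc (length xs)               ≤⟨ s≤s (length-⊆ xs! xs⊆asbs) ⟩
    suc (length (as ++ bs))       ≡⟨ cong suc (length-++ as) ⟩
    suc (length as + length bs)   ≡⟨ +-suc (length as) (length bs) ⟨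
    length as + suc (length bs)   ≡⟨ length-++ as ⟨
    length (as ++ x ∷ bs)         ∎
    where
    open ≤-Reasoning
    xs⊆asbs : _ ⊆ as ++ bs
    xs⊆asbs y∈xs with ∈-++⁻ as (xs⊆ys (there y∈xs))
    ... | inj₁ y∈as         = ∈-++⁺ˡ y∈as
    ... | inj₂ (here refl)  = contradiction refl (lookup x≢xs y∈xs)
    ... | inj₂ (there y∈bs) = ∈-++⁺ʳ as y∈bs

  -- Both final counts compare lists produced in unrelated orders, so lengths are compared through
  -- mutual inclusion of duplicate-free lists.
  length-≡-⊆⊇ : {xs ys : List A} → Unique xs → Unique ys → xs ⊆ ys → ys ⊆ xs →
                length xs ≡ length ys
  length-≡-⊆⊇ xs! ys! p q = ≤-antisym (length-⊆ xs! p) (length-⊆ ys! q)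

  unique-++⁻ˡ : ∀ xs {ys : List A} → Unique (xs ++ ys) → Unique xs
  unique-++⁻ˡ []       _          = []
  unique-++⁻ˡ (x ∷ xs) (p ∷ xs!) = All.++⁻ˡ xs p ∷ unique-++⁻ˡ xs xs!

  unique-++⁻ʳ : ∀ xs {ys : List A} → Unique (xs ++ ys) → Unique ys
  unique-++⁻ʳ []       ys!        = ys!
  unique-++⁻ʳ (x ∷ xs) (_ ∷ xs!) = unique-++⁻ʳ xs xs!

  unique-++⇒≢ : ∀ xs {ys : List A} → Unique (xs ++ ys) → ∀ {x y} → x ∈ xs → y ∈ ys → x ≢ y
  unique-++⇒≢ (x ∷ xs) (p ∷ _)   (here refl)  y∈ys = lookup p (∈-++⁺ʳ xs y∈ys)
  unique-++⇒≢ (x ∷ xs) (_ ∷ xs!) (there x∈xs) y∈ys = unique-++⇒≢ xs xs! x∈xs y∈ys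

  ++-∷-injective : ∀ {m : A} xs xs′ {ys ys′} → m ∉ xs → m ∉ xs′ →
                   xs ++ m ∷ ys ≡ xs′ ++ m ∷ ys′ → xs ≡ xs′ × ys ≡ ys′
  ++-∷-injective []       []         _    _     refl = refl , refl
  ++-∷-injective []       (x ∷ xs′)  _    m∉xs′ refl = contradiction (here refl) m∉xs′
  ++-∷-injective (x ∷ xs) []         m∉xs _     refl = contradiction (here refl) m∉xs
  ++-∷-injective (x ∷ xs) (x′ ∷ xs′) m∉xs m∉xs′ eq
    with refl , eq′ ← ∷-injective eq
    with refl , ys≡ ← ++-∷-injective xs xs′ (m∉xs ∘ there) (m∉xs′ ∘ there) eq′ = refl , ys≡

InRange : ℕ → ℕ → List ℕ → Set
InRange lo n w = ∀ {x} → x ∈ w → lo < x × x ≤ lo + n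

_≫_ : List ℕ → List ℕ → Set
xs ≫ ys = ∀ {x y} → x ∈ xs → y ∈ ys → y < x

pigeonhole : ∀ {lo n w} → Unique w → InRange lo n w → length w ≤ n
pigeonhole {lo} {n} w! w∈ = subst (_ ≤_) (trans (length-map _ (upTo n)) (length-upTo n)) (length-⊆ w! w⊆)
  where
  w⊆ : _ ⊆ map (λ k → suc (lo + k)) (upTo n)
  w⊆ x∈w with w∈ x∈w
  ... | lo<x , x≤ with m≤n⇒∃[o]m+o≡n lo<x
  ...   | k , refl = ∈-map⁺ _ (∈-upTo⁺ (+-cancelˡ-< lo k n x≤))

at-++ˡ : ∀ xs {ys p} → p < length xs → at (xs ++ ys) p ≡ at xs p
at-++ˡ (x ∷ xs) {p = zero}  _       = refl
at-++ˡ (x ∷ xs) {p = suc p} (s≤s l) = at-++ˡ xs l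

at-++ʳ : ∀ xs {ys} p → at (xs ++ ys) (length xs + p) ≡ at ys p
at-++ʳ []       p = refl
at-++ʳ (x ∷ xs) p = at-++ʳ xs p

at-∈ : ∀ {xs p} → p < length xs → at xs p ∈ xs
at-∈ {x ∷ xs} {zero}  _       = here refl
at-∈ {x ∷ xs} {suc p} (s≤s l) = there (at-∈ l)

∈-at : ∀ {xs x} → x ∈ xs → ∃[ p ] p < length xs × at xs p ≡ x
∈-at (here refl) = 0 , s≤s z≤n , refl
∈-at (there x∈)  with p , l , e ← ∈-at x∈ = suc p , s≤s l , e

data Side (a : ℕ) : ℕ → Set where
  left  : ∀ {p} → p < a → Side a p
  right : ∀ p → Side a (a + p)

side : ∀ a p → Side a p
side a p with p <? a
... | yes p<a = left p<a
... | no  p≮a with m≤n⇒∃[o]m+o≡n (≮⇒≥ p≮a)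
...   | q , refl = right q

right-< : ∀ xs {ys : List ℕ} {p} → length xs + p < length (xs ++ ys) → p < length ys
right-< xs l = +-cancelˡ-< (length xs) _ _ (subst (_ <_) (length-++ xs) l)

right-<⁺ : ∀ xs {ys : List ℕ} {p} → p < length ys → length xs + p < length (xs ++ ys)
right-<⁺ xs l = subst (_ <_) (sym (length-++ xs)) (+-monoʳ-< (length xs) l)

left-<⁺ : ∀ xs {ys : List ℕ} {p} → p < length xs → p < length (xs ++ ys)
left-<⁺ xs l = subst (_ <_) (sym (length-++ xs)) (≤-trans l (m≤m+n _ _))

-- Avoidance of 132 under concatenation

Avoids : List ℕ → Set
Avoids w = ∀ {p q r} → p < q → q < r → r < length w → at w p < at w r → at w r < at w q → ⊥

avoids-++⁻ˡ : ∀ xs {ys} → Avoids (xs ++ ys) → Avoids xs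
avoids-++⁻ˡ xs {ys} av p<q q<r r< a b
  rewrite sym (at-++ˡ xs {ys} r<)
        | sym (at-++ˡ xs {ys} (<-trans q<r r<))
        | sym (at-++ˡ xs {ys} (<-trans p<q (<-trans q<r r<))) = av p<q q<r (left-<⁺ xs r<) a b

avoids-++⁻ʳ : ∀ xs {ys} → Avoids (xs ++ ys) → Avoids ys
avoids-++⁻ʳ xs {ys} av {p} {q} {r} p<q q<r r< a b
  rewrite sym (at-++ʳ xs {ys} p) | sym (at-++ʳ xs {ys} q) | sym (at-++ʳ xs {ys} r) =
  av (+-monoʳ-< (length xs) p<q) (+-monoʳ-< (length xs) q<r) (right-<⁺ xs r<) a b


-- A pattern meeting both parts starts in `xs` and ends in `ys`, but its first entry would have to
-- be smaller than its last.
avoids-++⁺ : ∀ {xs ys} → xs ≫ ys → Avoids xs → Avoids ys → Avoids (xs ++ ys)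
avoids-++⁺ {xs} {ys} xs≫ys avˡ avʳ {p} {q} {r} p<q q<r r< a b
  with side (length xs) p | side (length xs) q | side (length xs) r
... | left p<  | left q<  | left r<′
  rewrite at-++ˡ xs {ys} p< | at-++ˡ xs {ys} q< | at-++ˡ xs {ys} r<′ = avˡ p<q q<r r<′ a b
... | _        | right q′ | left r<′ = m+n≮m _ q′ (<-trans q<r r<′)
... | right p′ | left q<  | _        = m+n≮m _ p′ (<-trans p<q q<)
... | left p<  | _        | right r′
  rewrite at-++ˡ xs {ys} p< | at-++ʳ xs {ys} r′ = <-asym a (xs≫ys (at-∈ p<) (at-∈ (right-< xs r<)))
... | right p′ | right q′ | right r′
  rewrite at-++ʳ xs {ys} p′ | at-++ʳ xs {ys} q′ | at-++ʳ xs {ys} r′ =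
  avʳ (+-cancelˡ-< (length xs) _ _ p<q) (+-cancelˡ-< (length xs) _ _ q<r) (right-< xs r<) a b

at-∷ʳ : ∀ xs {m} p → p < length (xs ++ [ m ]) → (p < length xs) ⊎ (p ≡ length xs × at (xs ++ [ m ]) p ≡ m)
at-∷ʳ xs p l with side (length xs) p
... | left p<     = inj₁ p<
... | right zero  = inj₂ (+-identityʳ _ , at-++ʳ xs 0)
... | right (suc q) with s≤s () ← right-< xs {p = suc q} l

avoids-∷ʳ : ∀ {xs m} → (∀ {x} → x ∈ xs → x < m) → Avoids xs → Avoids (xs ++ [ m ])
avoids-∷ʳ {xs} {m} xs<m av {p} {q} {r} p<q q<r r< a b with at-∷ʳ xs r r<
... | inj₁ r<′
  rewrite at-++ˡ xs {[ m ]} (<-trans p<q (<-trans q<r r<′)) | at-++ˡ xs {[ m ]} (<-trans q<r r<′)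
        | at-++ˡ xs {[ m ]} r<′ = av p<q q<r r<′ a b
... | inj₂ (refl , e) rewrite e | at-++ˡ xs {[ m ]} q<r = <-asym b (xs<m (at-∈ q<r))

-- If `x < y`, then `x`, `m`, `y` form a 132 pattern with `m` as its largest entry.
avoids⇒≫ : ∀ xs {m ys} → Avoids (xs ++ m ∷ ys) → (∀ {y} → y ∈ ys → y < m) →
           (∀ {x y} → x ∈ xs → y ∈ ys → x ≢ y) → xs ≫ ys
avoids⇒≫ xs {m} {ys} av ys<m xs≢ys {x} {y} x∈ y∈ with <-cmp y x | ∈-at x∈ | ∈-at y∈
... | tri< y<x _ _ | _ | _ = y<x
... | tri≈ _ y≡x _ | _ | _ = contradiction (sym y≡x) (xs≢ys x∈ y∈)
... | tri> _ _ x<y | p , p< , refl | q , q< , refl = ⊥-elim 132-pattern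
  where
  w = xs ++ m ∷ ys
  at-p : at w p ≡ at xs p
  at-p = at-++ˡ xs p<
  at-m : at w (length xs + 0) ≡ m
  at-m = at-++ʳ xs 0
  at-q : at w (length xs + suc q) ≡ at ys q
  at-q = at-++ʳ xs (suc q)
  132-pattern : ⊥
  132-pattern = av (≤-trans p< (m≤m+n _ 0)) (+-monoʳ-< (length xs) (s≤s z≤n))
    (right-<⁺ xs (s≤s q<))
    (subst₂ _<_ (sym at-p) (sym at-q) x<y)
    (subst₂ _<_ (sym at-q) (sym at-m) (ys<m (at-∈ q<)))

-- The values of perm c t are c + 1, …, c + size t.
perm : ℕ → Tree → List ℕ
perm c leaf         = []
perm c t@(node l r) = (perm (c + size r) l ++ [ c + size t ]) ++ perm c r

length-perm : ∀ c t → length (perm c t) ≡ size t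
length-perm c leaf       = refl
length-perm c (node l r)
  rewrite length-++ (perm (c + size r) l ++ [ c + suc (size l + size r) ]) {perm c r}
        | length-++ (perm (c + size r) l) {[ c + suc (size l + size r) ]}
        | length-perm (c + size r) l | length-perm c r | +-comm (size l) 1 = refl

module _ (c : ℕ) (l r : Tree) where

  private
    a b m : ℕ
    a = size l
    b = size r
    m = c + suc (a + b)

    c+b+a<m : suc (c + b + a) ≡ m
    c+b+a<m = trans (cong suc (trans (+-assoc c b a) (cong (c +_) (+-comm b a)))) (sym (+-suc c (a + b)))

  module _ (rangeˡ : InRange (c + b) a (perm (c + b) l)) (rangeʳ : InRange c b (perm c r)) where

    perm-left< : ∀ {x} → x ∈ perm (c + b) l → x < m
    perm-left< x∈ = ≤-trans (s≤s (proj₂ (rangeˡ x∈))) (≤-reflexive c+b+a<m)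

    perm-left>right : perm (c + b) l ≫ perm c r
    perm-left>right x∈ y∈ = ≤-<-trans (proj₂ (rangeʳ y∈)) (proj₁ (rangeˡ x∈))

    perm-≫ : (perm (c + b) l ++ [ m ]) ≫ perm c r
    perm-≫ x∈ y∈ with ∈-++⁻ (perm (c + b) l) x∈
    ... | inj₁ x∈l         = perm-left>right x∈l y∈
    ... | inj₂ (here refl) =
      ≤-trans (s≤s (≤-trans (proj₂ (rangeʳ y∈)) (m≤m+n (c + b) a))) (≤-reflexive c+b+a<m)

    perm-range-node : InRange c (suc (a + b)) (perm c (node l r))
    perm-range-node x∈ with ∈-++⁻ (perm (c + b) l ++ [ m ]) x∈
    ... | inj₂ x∈r = proj₁ (rangeʳ x∈r) ,
      ≤-trans (proj₂ (rangeʳ x∈r)) (+-monoʳ-≤ c (≤-trans (m≤n+m b a) (n≤1+n _)))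
    ... | inj₁ x∈′ with ∈-++⁻ (perm (c + b) l) x∈′
    ...   | inj₁ x∈l         = ≤-trans (s≤s (m≤m+n c b)) (proj₁ (rangeˡ x∈l)) , <⇒≤ (perm-left< x∈l)
    ...   | inj₂ (here refl) = m<m+n c (s≤s z≤n) , ≤-refl

perm-range : ∀ c t → InRange c (size t) (perm c t)
perm-range c (node l r) = perm-range-node c l r (perm-range (c + size r) l) (perm-range c r)

top : ℕ → Tree → Tree → ℕ
top c l r = c + suc (size l + size r)

permˡ< : ∀ c l r {x} → x ∈ perm (c + size r) l → x < top c l r
permˡ< c l r = perm-left< c l r (perm-range (c + size r) l) (perm-range c r)

permˡʳ≫ : ∀ c l r → (perm (c + size r) l ++ [ top c l r ]) ≫ perm c r
permˡʳ≫ c l r = perm-≫ c l r (perm-range (c + size r) l) (perm-range c r)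

perm-unique : ∀ c t → Unique (perm c t)
perm-unique c leaf       = []
perm-unique c (node l r) =
  Unique.++⁺
    (Unique.++⁺ (perm-unique (c + size r) l) ([] ∷ []) λ { (x∈ , here refl) → <-irrefl refl (permˡ< c l r x∈) })
    (perm-unique c r)
    λ (x∈ , y∈) → <-irrefl refl (permˡʳ≫ c l r x∈ y∈)

perm-avoids : ∀ c t → Avoids (perm c t)
perm-avoids c leaf       _ _ ()
perm-avoids c (node l r) =
  avoids-++⁺ {ys = perm c r} (permˡʳ≫ c l r) (avoids-∷ʳ (permˡ< c l r) (perm-avoids (c + size r) l)) (perm-avoids c r)

-- Equal lengths force equal maxima, and since the maximum does not occur in either left part, it
-- splits both words at the same place.
perm-injective : ∀ c t t′ → perm c t ≡ perm c t′ → t ≡ t′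
perm-size : ∀ c t t′ → perm c t ≡ perm c t′ → size t ≡ size t′
perm-size c t t′ eq = trans (sym (length-perm c t)) (trans (cong length eq) (length-perm c t′))
perm-injective c leaf          leaf            eq = refl
perm-injective c leaf          t′@(node _ _)   eq = contradiction (perm-size c leaf t′ eq) λ ()
perm-injective c t@(node _ _)  leaf            eq = contradiction (perm-size c t leaf eq) λ ()
perm-injective c t@(node l r)  t′@(node l′ r′) eq
  with eqˡ , eqʳ ← ++-∷-injective (perm (c + size r) l) (perm (c + size r′) l′)
         (λ m∈ → <-irrefl refl (permˡ< c l r m∈))
         (λ m∈ → <-irrefl (cong (c +_) (perm-size c t t′ eq)) (permˡ< c l′ r′ m∈))
         (trans (sym (++-assoc (perm (c + size r) l) [ top c l r ] (perm c r)))
           (trans eq (trans (++-assoc (perm (c + size r′) l′) [ top c l′ r′ ] (perm c r′))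
             (cong (λ m → perm (c + size r′) l′ ++ m ∷ perm c r′) (sym (cong (c +_) (perm-size c t t′ eq)))))))
  -- The left parts are shifted by `size r` and `size r′`, so the right subtrees have to be
  -- identified before the recursion on the left.
  with refl ← perm-injective c r r′ eqʳ
  = cong (λ l → node l r) (perm-injective (c + size r) l l′ eqˡ)

-- The bound `k` drives the recursion, because the two parts around the maximum are not structurally
-- smaller than `w`.
perm-complete : ∀ k c w → length w ≤ k → Unique w → InRange c (length w) w → Avoids w →
                ∃[ t ] w ≡ perm c t
perm-complete k c [] _ _ _ _ = leaf , refl
perm-complete (suc k) c w@(_ ∷ v) (s≤s |v|≤k) w! w∈ av with (c + length w) ∈? w
-- Without the top value, `suc (length v)` distinct entries would share only `length v` values.
... | no m∉w = contradiction (pigeonhole w! w∈′) (<-irrefl refl)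
  where
  w∈′ : InRange c (length v) w
  w∈′ x∈w = proj₁ (w∈ x∈w) , ≤-pred (≤-trans (≤∧≢⇒< (proj₂ (w∈ x∈w)) λ { refl → m∉w x∈w })
    (≤-reflexive (+-suc c (length v))))
... | yes m∈w with xs , ys , w≡ ← ∈-∃++ m∈w = node l r , w≡perm
  where
  m = c + length w
  w′! : Unique (xs ++ m ∷ ys)
  w′! = subst Unique w≡ w!
  w′-range : InRange c (length w) (xs ++ m ∷ ys)
  w′-range = subst (InRange c (length w)) w≡ w∈
  av′ : Avoids (xs ++ m ∷ ys)
  av′ = subst Avoids w≡ av
  m∷ys! : Unique (m ∷ ys)
  m∷ys! = unique-++⁻ʳ xs w′!
  |v|≡ : length v ≡ length xs + length ys
  |v|≡ = suc-injective (trans (cong length w≡) (trans (length-++ xs) (+-suc (length xs) (length ys))))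
  in-xs : ∀ {x} → x ∈ xs → x ∈ xs ++ m ∷ ys
  in-xs = ∈-++⁺ˡ
  in-ys : ∀ {y} → y ∈ ys → y ∈ xs ++ m ∷ ys
  in-ys y∈ = ∈-++⁺ʳ xs (there y∈)
  xs! : Unique xs
  xs! = unique-++⁻ˡ xs w′!
  ys! : Unique ys
  ys! = unique-++⁻ʳ [ m ] m∷ys!
  xs<m : ∀ {x} → x ∈ xs → x < m
  xs<m x∈ = ≤∧≢⇒< (proj₂ (w′-range (in-xs x∈))) (unique-++⇒≢ xs w′! x∈ (here refl))
  ys<m : ∀ {y} → y ∈ ys → y < m
  ys<m y∈ = ≤∧≢⇒< (proj₂ (w′-range (in-ys y∈))) (unique-++⇒≢ [ m ] m∷ys! (here refl) y∈ ∘ sym)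
  xs≫ys : xs ≫ ys
  xs≫ys = avoids⇒≫ xs av′ ys<m λ x∈ y∈ → unique-++⇒≢ xs w′! x∈ (there y∈)
  -- For `y` in `ys`, all of `xs` fits strictly above `y` and below `m`. Counting these values
  -- bounds `y` from above.
  ys-range : InRange c (length ys) ys
  ys-range {y} y∈ = proj₁ (w′-range (in-ys y∈)) , +-cancelʳ-≤ (length xs) _ _ (begin
    y + length xs                  ≤⟨ +-monoʳ-≤ y (pigeonhole xs! xs-in) ⟩
    y + (c + length v ∸ y)         ≡⟨ m+[n∸m]≡n y≤ ⟩
    c + length v                   ≡⟨ cong (c +_) (trans |v|≡ (+-comm (length xs) (length ys))) ⟩
    c + (length ys + length xs)    ≡⟨ +-assoc c (length ys) (length xs) ⟨
    c + length ys + length xs      ∎)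
    where
    open ≤-Reasoning
    y≤ : y ≤ c + length v
    y≤ = ≤-pred (subst (y <_) (+-suc c (length v)) (ys<m y∈))
    xs-in : InRange y (c + length v ∸ y) xs
    xs-in {x} x∈ = xs≫ys x∈ y∈ ,
      subst (x ≤_) (sym (m+[n∸m]≡n y≤)) (≤-pred (subst (x <_) (+-suc c (length v)) (xs<m x∈)))
  xs-range : InRange (c + length ys) (length xs) xs
  xs-range {x} x∈ = lower , subst (x ≤_) c+|v|≡ (≤-pred (subst (x <_) (+-suc c (length v)) (xs<m x∈)))
    where
    c+|v|≡ : c + length v ≡ c + length ys + length xs
    c+|v|≡ = trans (cong (c +_) (trans |v|≡ (+-comm (length xs) (length ys)))) (sym (+-assoc c (length ys) (length xs)))
    -- Dually, all of `ys` fits into the `j` values between `c` and `x`, where `x` is `suc c + j`.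
    lower : c + length ys < x
    lower with m≤n⇒∃[o]m+o≡n (proj₁ (w′-range (in-xs x∈)))
    ... | j , refl = s≤s (+-monoʳ-≤ c (pigeonhole ys! λ y∈ →
      proj₁ (w′-range (in-ys y∈)) , ≤-pred (xs≫ys x∈ y∈)))
  ihʳ : ∃[ t ] ys ≡ perm c t
  ihʳ = perm-complete k c ys (≤-trans (subst (length ys ≤_) (sym |v|≡) (m≤n+m _ _)) |v|≤k)
    ys! ys-range (avoids-++⁻ʳ [ m ] (avoids-++⁻ʳ xs av′))
  ihˡ : ∃[ t ] xs ≡ perm (c + length ys) t
  ihˡ = perm-complete k (c + length ys) xs (≤-trans (subst (length xs ≤_) (sym |v|≡) (m≤m+n _ _)) |v|≤k)
    xs! xs-range (avoids-++⁻ˡ xs av′)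
  l = proj₁ ihˡ
  r = proj₁ ihʳ
  |ys|≡ : length ys ≡ size r
  |ys|≡ = trans (cong length (proj₂ ihʳ)) (length-perm c r)
  xs≡ : xs ≡ perm (c + size r) l
  xs≡ = trans (proj₂ ihˡ) (cong (λ b → perm (c + b) l) |ys|≡)
  |v|≡′ : length v ≡ size l + size r
  |v|≡′ = trans |v|≡ (cong₂ _+_ (trans (cong length (proj₂ ihˡ)) (length-perm _ l)) |ys|≡)
  w≡perm : w ≡ perm c (node l r)
  w≡perm = begin
    w                                                ≡⟨ w≡ ⟩
    xs ++ m ∷ ys                                     ≡⟨ ++-assoc xs [ m ] ys ⟨
    (xs ++ [ m ]) ++ ys                              ≡⟨ cong₂ (λ m xs → (xs ++ [ m ]) ++ ys) (cong (λ n → c + suc n) |v|≡′) xs≡ ⟩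
    (perm (c + size r) l ++ [ top c l r ]) ++ ys     ≡⟨ cong ((perm (c + size r) l ++ [ top c l r ]) ++_) (proj₂ ihʳ) ⟩
    perm c (node l r)                                ∎
    where open ≡-Reasoning

-- Decoding the Boolean predicates

T-not⁺ : ∀ {b} → ¬ T b → T (not b)
T-not⁺ {false} _  = _
T-not⁺ {true}  ¬t = ¬t _

T-not⁻ : ∀ {b} → T (not b) → ¬ T b
T-not⁻ {false} _ ()

T-∧⁺ : ∀ {a b} → T a → T b → T (a ∧ b)
T-∧⁺ {true} _ b = b

T-∧⁻ : ∀ {a b} → T (a ∧ b) → T a × T b
T-∧⁻ {true} b = _ , b

any-upTo⁺ : ∀ (f : ℕ → Bool) {n i} → i < n → T (f i) → T (any f (upTo n))
any-upTo⁺ f i<n = any⁺ f ∘ lose (∈-upTo⁺ i<n)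

any-upTo⁻ : ∀ (f : ℕ → Bool) n → T (any f (upTo n)) → ∃[ i ] i < n × T (f i)
any-upTo⁻ f n t with find (any⁻ f (upTo n) t)
... | i , i∈ , fi = i , ∈-upTo⁻ i∈ , fi

module _ (w : List ℕ) where

  private
    pattern132 : ℕ → ℕ → ℕ → Bool
    pattern132 r q p = (at w p <ᵇ at w r) ∧ (at w r <ᵇ at w q)

    anyPattern₁ : ℕ → ℕ → Bool
    anyPattern₁ r q = any (pattern132 r q) (upTo q)

    anyPattern₂ : ℕ → Bool
    anyPattern₂ r = any (anyPattern₁ r) (upTo r)

  avoids132⁻ : T (avoids132 w) → Avoids w
  avoids132⁻ t {p} {q} {r} p<q q<r r< a b = T-not⁻ t
    (any-upTo⁺ anyPattern₂ r< (any-upTo⁺ (anyPattern₁ r) q<r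
      (any-upTo⁺ (pattern132 r q) p<q (T-∧⁺ (<⇒<ᵇ a) (<⇒<ᵇ b)))))

  avoids132⁺ : Avoids w → T (avoids132 w)
  avoids132⁺ av = T-not⁺ λ t →
    let r , r< , t₁  = any-upTo⁻ anyPattern₂ (length w) t
        q , q<r , t₂ = any-upTo⁻ (anyPattern₁ r) r t₁
        p , p<q , t₃ = any-upTo⁻ (pattern132 r q) q t₂
        a , b = T-∧⁻ {at w p <ᵇ at w r} t₃
    in av p<q q<r r< (<ᵇ⇒< _ _ a) (<ᵇ⇒< _ _ b)

distinct⁻ : ∀ w → T (distinct w) → Unique w
distinct⁻ []      _ = []
distinct⁻ (x ∷ w) t with T-∧⁻ {not (any (x ≡ᵇ_) w)} t
... | x∉ , t′ = tabulate (λ y∈ x≡y → T-not⁻ x∉ (any⁺ (x ≡ᵇ_) (lose y∈ (≡⇒≡ᵇ x _ x≡y)))) ∷ distinct⁻ w t′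

distinct⁺ : ∀ w → Unique w → T (distinct w)
distinct⁺ []      _          = _
distinct⁺ (x ∷ w) (x≢w ∷ w!) = T-∧⁺ (T-not⁺ λ t → x∉ (find (any⁻ (x ≡ᵇ_) w t))) (distinct⁺ w w!)
  where
  x∉ : ∃[ y ] y ∈ w × T (x ≡ᵇ y) → ⊥
  x∉ (y , y∈ , t) = lookup x≢w y∈ (≡ᵇ⇒≡ x y t)

∈-words⁻ : ∀ m n {w} → w ∈ words m n → length w ≡ m × InRange 0 n w
∈-words⁻ zero    n (here refl) = refl , λ ()
∈-words⁻ (suc m) n w∈ with find (∈-concatMap⁻ (λ w → map (λ x → suc x ∷ w) (upTo n)) {xs = words m n} w∈)
... | v , v∈ , w∈′ with ∈-map⁻ (λ x → suc x ∷ v) w∈′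
...   | x , x∈ , refl with ∈-words⁻ m n v∈
...     | eq , range = cong suc eq , λ { (here refl) → s≤s z≤n , ∈-upTo⁻ x∈ ; (there y∈) → range y∈ }

∈-words⁺ : ∀ n w → InRange 0 n w → w ∈ words (length w) n
∈-words⁺ n []      _     = here refl
∈-words⁺ n (x ∷ w) range with range (here refl)
∈-words⁺ n (suc x ∷ w) range | _ , x<n =
  ∈-concatMap⁺ (λ w → map (λ x → suc x ∷ w) (upTo n))
    (lose (∈-words⁺ n w (range ∘ there)) (∈-map⁺ (λ x → suc x ∷ w) (∈-upTo⁺ x<n)))

words-unique : ∀ m n → Unique (words m n)
words-unique zero    n = [] ∷ []
words-unique (suc m) n = Unique.concat⁺
  (All.map⁺ (tabulate λ _ → Unique.map⁺ (suc-injective ∘ ∷-injectiveˡ) (Unique.upTo⁺ n)))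
  (AllPairs.map⁺ (AllPairs.map disjoint (words-unique m n)))
  where
  prepend : List ℕ → List (List ℕ)
  prepend w = map (λ x → suc x ∷ w) (upTo n)
  same : ∀ {w v u} → u ∈ prepend w → u ∈ prepend v → w ≡ v
  same {w} {v} p q with ∈-map⁻ (λ x → suc x ∷ w) p | ∈-map⁻ (λ x → suc x ∷ v) q
  ... | _ , _ , refl | _ , _ , eq = ∷-injectiveʳ eq
  disjoint : ∀ {w v} → w ≢ v → Disjoint (prepend w) (prepend v)
  disjoint w≢v (p , q) = w≢v (same p q)

∈-perms⁻ : ∀ n {w} → w ∈ perms n → length w ≡ n × InRange 0 n w × Unique w
∈-perms⁻ n {w} w∈ with ∈-filter⁻ (λ w → T? (distinct w)) {xs = words n n} w∈
... | w∈′ , t with ∈-words⁻ n n w∈′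
...   | eq , range = eq , range , distinct⁻ w t

∈-perms⁺ : ∀ w → InRange 0 (length w) w → Unique w → w ∈ perms (length w)
∈-perms⁺ w range w! = ∈-filter⁺ (λ w → T? (distinct w)) (∈-words⁺ (length w) w range) (distinct⁺ w w!)

perms-unique : ∀ n → Unique (perms n)
perms-unique n = Unique.filter⁺ (λ w → T? (distinct w)) (words-unique n n)

-- Left-to-right minima of concatenations

entry : ℕ → List ℕ → ℕ → ℕ
entry d []       j       = d
entry d (k ∷ ks) zero    = k
entry d (k ∷ ks) (suc j) = entry d ks j

-- The recursion inside `kPos` enters only through its defining equations, with `d` standing for the
-- end position k_{a+1}. The premise `suc j ≡ t` allows the caller to keep `t` an abstract variable.
entry-unique : ∀ d (f : List ℕ → ℕ → ℕ) → (∀ t → f [] t ≡ d) → (∀ k ks → f (k ∷ ks) 1 ≡ k) →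
               (∀ k ks t → f (k ∷ ks) (2 + t) ≡ f ks (1 + t)) →
               ∀ ks t j → suc j ≡ t → f ks t ≡ entry d ks j
entry-unique d f e₀ e₁ e₂ []       t j       _    = e₀ t
entry-unique d f e₀ e₁ e₂ (k ∷ ks) _ zero    refl = e₁ k ks
entry-unique d f e₀ e₁ e₂ (k ∷ ks) _ (suc j) refl =
  trans (e₂ k ks j) (entry-unique d f e₀ e₁ e₂ ks (suc j) j refl)

-- The recursive function local to kPos cannot be named here, so kPosGo is left
-- to unification.  Both occurrences of the index have to be abstracted
-- separately to make the unification problem a pattern.
mutual
  kPosGo : List ℕ → ℕ → List ℕ → ℕ → ℕ
  kPosGo = _

  kPos≡entry : ∀ w j → kPos w (suc j) ≡ entry (length w) (ltrMinPos w) j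
  kPos≡entry w j with ltrMinPos w
  kPos≡entry w j       | []     = refl
  kPos≡entry w zero    | k ∷ ks = refl
  kPos≡entry w (suc j) | k ∷ ks with suc (suc j)
  ... | T with suc j in eq
  ...   | t = entry-unique (length w) (kPosGo w T)
                (λ _ → refl) (λ _ _ → refl) (λ _ _ _ → refl) ks t j eq

filter-cong-∈ : ∀ {A : Set} (f g : A → Bool) xs → (∀ {x} → x ∈ xs → f x ≡ g x) →
                filter (λ x → T? (f x)) xs ≡ filter (λ x → T? (g x)) xs
filter-cong-∈ f g []       eq = refl
filter-cong-∈ f g (x ∷ xs) eq with f x | g x | eq (here refl)
... | true  | true  | _ = cong (x ∷_) (filter-cong-∈ f g xs (eq ∘ there))
... | false | false | _ = filter-cong-∈ f g xs (eq ∘ there)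

filter-map : ∀ {A B : Set} (f : B → Bool) (h : A → B) xs →
             filter (λ x → T? (f x)) (map h xs) ≡ map h (filter (λ x → T? (f (h x))) xs)
filter-map f h []       = refl
filter-map f h (x ∷ xs) with f (h x)
... | true  = cong (h x ∷_) (filter-map f h xs)
... | false = filter-map f h xs

T-≡⁺ : ∀ {a b} → (T a → T b) → (T b → T a) → a ≡ b
T-≡⁺ {false} {false} _ _ = refl
T-≡⁺ {true}  {true}  _ _ = refl
T-≡⁺ {false} {true}  _ g = ⊥-elim (g _)
T-≡⁺ {true}  {false} f _ = ⊥-elim (f _)

applyUpTo-+ : ∀ {A : Set} (f : ℕ → A) m n → applyUpTo f (m + n) ≡ applyUpTo f m ++ applyUpTo (f ∘ (m +_)) n
applyUpTo-+ f zero    n = refl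
applyUpTo-+ f (suc m) n = cong (f 0 ∷_) (applyUpTo-+ (f ∘ suc) m n)

upTo-+ : ∀ m n → upTo (m + n) ≡ upTo m ++ map (m +_) (upTo n)
upTo-+ m n = trans (applyUpTo-+ (λ x → x) m n) (cong (upTo m ++_) (sym (map-upTo (m +_) n)))

isMin : List ℕ → ℕ → Bool
isMin w i = all (λ j → at w i <ᵇ at w j) (upTo i)

isMin⁺ : ∀ w {i} → (∀ {j} → j < i → at w i < at w j) → T (isMin w i)
isMin⁺ w lt = All.all⁻ _ (tabulate λ j∈ → <⇒<ᵇ (lt (∈-upTo⁻ j∈)))

isMin⁻ : ∀ w i → T (isMin w i) → ∀ {j} → j < i → at w i < at w j
isMin⁻ w i t j<i = <ᵇ⇒< _ _ (lookup (All.all⁺ _ (upTo i) t) (∈-upTo⁺ j<i))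

-- Whether a position is a minimum depends only on earlier entries, so `ys` does not affect the
-- minima of `xs`. The later positions are left undecided, since `ltrMinPos-++` and `ltrMinPos-∷ʳ`
-- settle them in different ways.
ltrMinPos-split : ∀ xs ys → ltrMinPos (xs ++ ys) ≡
  ltrMinPos xs ++ map (length xs +_) (filter (λ i → T? (isMin (xs ++ ys) (length xs + i))) (upTo (length ys)))
ltrMinPos-split xs ys = begin
  filter P? (upTo (length (xs ++ ys)))
    ≡⟨ cong (filter P?) (trans (cong upTo (length-++ xs)) (upTo-+ (length xs) (length ys))) ⟩
  filter P? (upTo (length xs) ++ map (length xs +_) (upTo (length ys)))
    ≡⟨ filter-++ P? (upTo (length xs)) _ ⟩
  filter P? (upTo (length xs)) ++ filter P? (map (length xs +_) (upTo (length ys)))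
    ≡⟨ cong₂ _++_ (filter-cong-∈ _ _ (upTo (length xs)) λ i∈ → prefix (∈-upTo⁻ i∈))
                  (filter-map (isMin (xs ++ ys)) (length xs +_) (upTo (length ys))) ⟩
  _ ∎
  where
  open ≡-Reasoning
  P? = λ i → T? (isMin (xs ++ ys) i)
  prefix : ∀ {i} → i < length xs → isMin (xs ++ ys) i ≡ isMin xs i
  prefix {i} i< = T-≡⁺
    (λ t → isMin⁺ xs λ j<i → subst₂ _<_ (at-++ˡ xs i<) (at-++ˡ xs (<-trans j<i i<)) (isMin⁻ (xs ++ ys) i t j<i))
    (λ t → isMin⁺ (xs ++ ys) λ j<i → subst₂ _<_ (sym (at-++ˡ xs i<)) (sym (at-++ˡ xs (<-trans j<i i<))) (isMin⁻ xs i t j<i))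

ltrMinPos-++ : ∀ xs {ys} → xs ≫ ys → ltrMinPos (xs ++ ys) ≡ ltrMinPos xs ++ map (length xs +_) (ltrMinPos ys)
ltrMinPos-++ xs {ys} xs≫ys = trans (ltrMinPos-split xs ys)
  (cong (λ ks → ltrMinPos xs ++ map (length xs +_) ks)
    (filter-cong-∈ _ _ (upTo (length ys)) λ i∈ → T-≡⁺ (to (∈-upTo⁻ i∈)) (from (∈-upTo⁻ i∈))))
  where
  to : ∀ {i} → i < length ys → T (isMin (xs ++ ys) (length xs + i)) → T (isMin ys i)
  to {i} i< t = isMin⁺ ys λ {j} j<i →
    subst₂ _<_ (at-++ʳ xs i) (at-++ʳ xs j) (isMin⁻ (xs ++ ys) _ t (+-monoʳ-< (length xs) j<i))
  from : ∀ {i} → i < length ys → T (isMin ys i) → T (isMin (xs ++ ys) (length xs + i))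
  from {i} i< t = isMin⁺ (xs ++ ys) smaller
    where
    smaller : ∀ {j} → j < length xs + i → at (xs ++ ys) (length xs + i) < at (xs ++ ys) j
    smaller {j} j<i with side (length xs) j
    ... | left j<   = subst₂ _<_ (sym (at-++ʳ xs i)) (sym (at-++ˡ xs j<)) (xs≫ys (at-∈ j<) (at-∈ i<))
    ... | right j′  = subst₂ _<_ (sym (at-++ʳ xs i)) (sym (at-++ʳ xs j′))
                        (isMin⁻ ys i t (+-cancelˡ-< (length xs) _ _ j<i))

ltrMinPos-∷ʳ : ∀ xs {m} → 0 < length xs → (∀ {x} → x ∈ xs → x < m) → ltrMinPos (xs ++ [ m ]) ≡ ltrMinPos xs
ltrMinPos-∷ʳ xs {m} 0< xs<m = trans (ltrMinPos-split xs [ m ])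
  (trans (cong (λ ks → ltrMinPos xs ++ map (length xs +_) ks)
           (filter-reject (λ i → T? (isMin (xs ++ [ m ]) (length xs + i))) {xs = []} ¬min))
         (++-identityʳ (ltrMinPos xs)))
  where
  ¬min : ¬ T (isMin (xs ++ [ m ]) (length xs + 0))
  ¬min t = <-asym (xs<m (at-∈ 0<)) (subst₂ _<_ (at-++ʳ xs 0) (at-++ˡ xs 0<)
    (isMin⁻ (xs ++ [ m ]) (length xs + 0) t (≤-trans 0< (m≤m+n _ 0))))

entry-++ˡ : ∀ {d e} xs {ys j} → j < length xs → entry d (xs ++ ys) j ≡ entry e xs j
entry-++ˡ (x ∷ xs) {j = zero}  _       = refl
entry-++ˡ (x ∷ xs) {j = suc j} (s≤s l) = entry-++ˡ xs l

entry-++ʳ : ∀ {d} xs {ys} j → entry d (xs ++ ys) (length xs + j) ≡ entry d ys j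
entry-++ʳ []       j = refl
entry-++ʳ (x ∷ xs) j = entry-++ʳ xs j

entry-map : ∀ {d} a ks j → entry (a + d) (map (a +_) ks) j ≡ a + entry d ks j
entry-map a []       j       = refl
entry-map a (k ∷ ks) zero    = refl
entry-map a (k ∷ ks) (suc j) = entry-map a ks j

entry-∈ : ∀ {d} {xs j} → j < length xs → entry d xs j ∈ xs
entry-∈ {xs = x ∷ xs} {zero}  _       = here refl
entry-∈ {xs = x ∷ xs} {suc j} (s≤s l) = there (entry-∈ l)

entry-end : ∀ {d} xs {j} → length xs ≤ j → entry d xs j ≡ d
entry-end []                   _       = refl
entry-end (x ∷ xs) {suc j} (s≤s l) = entry-end xs l

#min : List ℕ → ℕ
#min w = length (ltrMinPos w)

-- Minima, and with them rows and columns, are indexed from 0 from here on.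
pos val : List ℕ → ℕ → ℕ
pos w j = kPos w (suc j)
val w i = at w (pos w i)

pos-< : ∀ w {j} → j < #min w → pos w j < length w
pos-< w {j} j< rewrite kPos≡entry w j =
  ∈-upTo⁻ (proj₁ (∈-filter⁻ (λ i → T? (isMin w i)) {xs = upTo (length w)} (entry-∈ j<)))

pos-end : ∀ w → pos w (#min w) ≡ length w
pos-end w = trans (kPos≡entry w (#min w)) (entry-end (ltrMinPos w) ≤-refl)

pos-≤ : ∀ w {j} → j ≤ #min w → pos w j ≤ length w
pos-≤ w j≤ with m≤n⇒m<n∨m≡n j≤
... | inj₁ j<   = <⇒≤ (pos-< w j<)
... | inj₂ refl = ≤-reflexive (pos-end w)

pos-0 : ∀ w → pos w 0 ≡ 0
pos-0 []      = refl
pos-0 (x ∷ w) = refl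

val-∈ : ∀ w {i} → i < #min w → val w i ∈ w
val-∈ w i< = at-∈ (pos-< w i<)

-- Occupied boxes

-- The case `j = #min xs` is included: the end of the last column of `xs` is `length xs`, which is
-- also where `ys` has its first minimum, or its end if `ys` is empty.
pos-++ˡ : ∀ xs {ys j} → xs ≫ ys → j ≤ #min xs → pos (xs ++ ys) j ≡ pos xs j
pos-++ʳ : ∀ xs {ys} → xs ≫ ys → ∀ j → pos (xs ++ ys) (#min xs + j) ≡ length xs + pos ys j
pos-++ʳ xs {ys} xs≫ys j = begin
  pos (xs ++ ys) (#min xs + j)
    ≡⟨ kPos≡entry (xs ++ ys) (#min xs + j) ⟩
  entry (length (xs ++ ys)) (ltrMinPos (xs ++ ys)) (#min xs + j)
    ≡⟨ cong₂ (λ d ks → entry d ks (#min xs + j)) (length-++ xs) (ltrMinPos-++ xs xs≫ys) ⟩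
  entry (length xs + length ys) (ltrMinPos xs ++ map (length xs +_) (ltrMinPos ys)) (#min xs + j)
    ≡⟨ entry-++ʳ (ltrMinPos xs) j ⟩
  entry (length xs + length ys) (map (length xs +_) (ltrMinPos ys)) j
    ≡⟨ entry-map (length xs) (ltrMinPos ys) j ⟩
  length xs + entry (length ys) (ltrMinPos ys) j
    ≡⟨ cong (length xs +_) (kPos≡entry ys j) ⟨
  length xs + pos ys j ∎
  where open ≡-Reasoning
pos-++ˡ xs {ys} {j} xs≫ys j≤ with m≤n⇒m<n∨m≡n j≤
... | inj₁ j<   = begin
  pos (xs ++ ys) j
    ≡⟨ kPos≡entry (xs ++ ys) j ⟩
  entry (length (xs ++ ys)) (ltrMinPos (xs ++ ys)) j
    ≡⟨ cong (λ ks → entry (length (xs ++ ys)) ks j) (ltrMinPos-++ xs xs≫ys) ⟩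
  entry (length (xs ++ ys)) (ltrMinPos xs ++ map (length xs +_) (ltrMinPos ys)) j
    ≡⟨ entry-++ˡ (ltrMinPos xs) j< ⟩
  entry (length xs) (ltrMinPos xs) j
    ≡⟨ kPos≡entry xs j ⟨
  pos xs j ∎
  where open ≡-Reasoning
... | inj₂ refl = begin
  pos (xs ++ ys) (#min xs)       ≡⟨ cong (pos (xs ++ ys)) (+-identityʳ (#min xs)) ⟨
  pos (xs ++ ys) (#min xs + 0)   ≡⟨ pos-++ʳ xs xs≫ys 0 ⟩
  length xs + pos ys 0           ≡⟨ cong (length xs +_) (pos-0 ys) ⟩
  length xs + 0                  ≡⟨ +-identityʳ (length xs) ⟩
  length xs                      ≡⟨ pos-end xs ⟨
  pos xs (#min xs)               ∎
  where open ≡-Reasoning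

#min-++ : ∀ xs {ys} → xs ≫ ys → #min (xs ++ ys) ≡ #min xs + #min ys
#min-++ xs {ys} xs≫ys = trans (cong length (ltrMinPos-++ xs xs≫ys))
  (trans (length-++ (ltrMinPos xs)) (cong (#min xs +_) (length-map (length xs +_) (ltrMinPos ys))))

val-++ˡ : ∀ xs {ys i} → xs ≫ ys → i < #min xs → val (xs ++ ys) i ≡ val xs i
val-++ˡ xs {ys} xs≫ys i< =
  trans (cong (at (xs ++ ys)) (pos-++ˡ xs xs≫ys (<⇒≤ i<))) (at-++ˡ xs (pos-< xs i<))

val-++ʳ : ∀ xs {ys} → xs ≫ ys → ∀ i → val (xs ++ ys) (#min xs + i) ≡ val ys i
val-++ʳ xs {ys} xs≫ys i =
  trans (cong (at (xs ++ ys)) (pos-++ʳ xs xs≫ys i)) (at-++ʳ xs (pos ys i))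

-- In the top row the bound n + 1 of the paper excludes nothing.
Below : List ℕ → ℕ → ℕ → Set
Below w zero    v = ⊤
Below w (suc i) v = v < val w i

Occupied : List ℕ → ℕ → ℕ → Set
Occupied w i j = ∃[ p ] p < length w × pos w j < p × p < pos w (suc j) ×
                        val w i < at w p × Below w i (at w p)

module _ (xs : List ℕ) {ys : List ℕ} (xs≫ys : xs ≫ ys) where

  private
    w = xs ++ ys
    a = #min xs

    pos-suc : ∀ j → pos w (suc (a + j)) ≡ length xs + pos ys (suc j)
    pos-suc j = trans (cong (pos w) (sym (+-suc a j))) (pos-++ʳ xs xs≫ys (suc j))

    below-++ˡ⁻ : ∀ i {p} → i < a → p < length xs → Below w i (at w p) → Below xs i (at xs p)
    below-++ˡ⁻ zero    i< p< _ = tt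
    below-++ˡ⁻ (suc i) i< p< b = subst₂ _<_ (at-++ˡ xs p<) (val-++ˡ xs xs≫ys (<⇒≤ i<)) b

    below-++ˡ⁺ : ∀ i {p} → i < a → p < length xs → Below xs i (at xs p) → Below w i (at w p)
    below-++ˡ⁺ zero    i< p< _ = tt
    below-++ˡ⁺ (suc i) i< p< b = subst₂ _<_ (sym (at-++ˡ xs p<)) (sym (val-++ˡ xs xs≫ys (<⇒≤ i<))) b

    below-++ʳ⁻ : ∀ i {p} → Below w (a + i) (at w (length xs + p)) → Below ys i (at ys p)
    below-++ʳ⁻ zero    b = tt
    below-++ʳ⁻ (suc i) {p} b rewrite +-suc a i = subst₂ _<_ (at-++ʳ xs p) (val-++ʳ xs xs≫ys i) b

    -- The top row of `ys` has no upper bound, but as row `a` of `w` it is bounded by the last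
    -- minimum of `xs` if there is one. That bound holds because `xs` lies above `ys`.
    below-≫ : ∀ i {v} → i ≤ a → v ∈ ys → Below w i v
    below-≫ zero    _  _  = tt
    below-≫ (suc i) i< v∈ = subst (_ <_) (sym (val-++ˡ xs xs≫ys i<)) (xs≫ys (val-∈ xs i<) v∈)

    below-++ʳ⁺ : ∀ i {p} → p < length ys → Below ys i (at ys p) → Below w (a + i) (at w (length xs + p))
    below-++ʳ⁺ zero    {p} p< _ = subst₂ (Below w) (sym (+-identityʳ a)) (sym (at-++ʳ xs p)) (below-≫ a ≤-refl (at-∈ p<))
    below-++ʳ⁺ (suc i) {p} p< b rewrite +-suc a i = subst₂ _<_ (sym (at-++ʳ xs p)) (sym (val-++ʳ xs xs≫ys i)) b

  -- Entries of `ys` lie below all minima of `xs`, so no box in a row of `xs` and a column of `ys`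
  -- is occupied. The occupied boxes form two diagonal blocks, the second shifted by `a`.
  occupied-++⁻ : ∀ i j → i ≤ j → Occupied w i j →
    (j < a × Occupied xs i j) ⊎ (∃[ i′ ] ∃[ j′ ] i ≡ a + i′ × j ≡ a + j′ × Occupied ys i′ j′)
  occupied-++⁻ i j i≤j (p , p< , j<p , p<j , i<v , b) with side (length xs) p | side a j
  ... | left p<xs | left j<a = inj₁ (j<a , p , p<xs , subst (_< p) (pos-++ˡ xs xs≫ys (<⇒≤ j<a)) j<p ,
    subst (p <_) (pos-++ˡ xs xs≫ys j<a) p<j ,
    subst₂ _<_ (val-++ˡ xs xs≫ys (≤-<-trans i≤j j<a)) (at-++ˡ xs p<xs) i<v ,
    below-++ˡ⁻ i (≤-<-trans i≤j j<a) p<xs b)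
  ... | left p<xs | right j′ = contradiction (<-trans (subst (_< p) (pos-++ʳ xs xs≫ys j′) j<p) p<xs) (m+n≮m _ _)
  ... | right p′ | left j<a = contradiction
    (<-≤-trans (subst (_ <_) (pos-++ˡ xs xs≫ys j<a) p<j) (pos-≤ xs j<a)) (m+n≮m _ _)
  ... | right p′ | right j′ with side a i
  ...   | left i<a = contradiction (subst₂ _<_ (val-++ˡ xs xs≫ys i<a) (at-++ʳ xs p′) i<v)
    (<-asym (xs≫ys (val-∈ xs i<a) (at-∈ (right-< xs p<))))
  ...   | right i′ = inj₂ (i′ , j′ , refl , refl , p′ , right-< xs p< ,
    +-cancelˡ-< (length xs) _ _ (subst (_< _) (pos-++ʳ xs xs≫ys j′) j<p) ,
    +-cancelˡ-< (length xs) _ _ (subst (_ <_) (pos-suc j′) p<j) ,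
    subst₂ _<_ (val-++ʳ xs xs≫ys i′) (at-++ʳ xs p′) i<v ,
    below-++ʳ⁻ i′ b)

  occupied-++⁺ˡ : ∀ i j → i ≤ j → j < a → Occupied xs i j → Occupied w i j
  occupied-++⁺ˡ i j i≤j j<a (p , p< , j<p , p<j , i<v , b) =
    p , left-<⁺ xs p< , subst (_< p) (sym (pos-++ˡ xs xs≫ys (<⇒≤ j<a))) j<p ,
    subst (p <_) (sym (pos-++ˡ xs xs≫ys j<a)) p<j ,
    subst₂ _<_ (sym (val-++ˡ xs xs≫ys (≤-<-trans i≤j j<a))) (sym (at-++ˡ xs p<)) i<v ,
    below-++ˡ⁺ i (≤-<-trans i≤j j<a) p< b

  occupied-++⁺ʳ : ∀ i j → Occupied ys i j → Occupied w (a + i) (a + j)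
  occupied-++⁺ʳ i j (p , p< , j<p , p<j , i<v , b) =
    length xs + p , right-<⁺ xs p< ,
    subst (_< _) (sym (pos-++ʳ xs xs≫ys j)) (+-monoʳ-< (length xs) j<p) ,
    subst (_ <_) (sym (pos-suc j)) (+-monoʳ-< (length xs) p<j) ,
    subst₂ _<_ (sym (val-++ʳ xs xs≫ys i)) (sym (at-++ʳ xs p)) i<v ,
    below-++ʳ⁺ i p< b

module _ (xs : List ℕ) {m : ℕ} (0<xs : 0 < length xs) (xs<m : ∀ {x} → x ∈ xs → x < m) where

  private
    w = xs ++ [ m ]
    a = #min xs

    |w| : length w ≡ suc (length xs)
    |w| = trans (length-++ xs) (+-comm (length xs) 1)

    at-last : at w (length xs) ≡ m
    at-last = trans (cong (at w) (sym (+-identityʳ (length xs)))) (at-++ʳ xs 0)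

  #min-∷ʳ : #min w ≡ a
  #min-∷ʳ = cong length (ltrMinPos-∷ʳ xs 0<xs xs<m)

  pos-∷ʳ : ∀ {j} → j < a → pos w j ≡ pos xs j
  pos-∷ʳ {j} j< = trans (kPos≡entry w j) (trans (cong (λ ks → entry (length w) ks j) (ltrMinPos-∷ʳ xs 0<xs xs<m))
    (trans (cong (λ ks → entry (length w) ks j) (sym (++-identityʳ (ltrMinPos xs))))
      (trans (entry-++ˡ (ltrMinPos xs) j<) (sym (kPos≡entry xs j)))))

  pos-∷ʳ-end : pos w a ≡ suc (length xs)
  pos-∷ʳ-end = trans (cong (pos w) (sym #min-∷ʳ)) (trans (pos-end w) |w|)

  val-∷ʳ : ∀ {i} → i < a → val w i ≡ val xs i
  val-∷ʳ i< = trans (cong (at w) (pos-∷ʳ i<)) (at-++ˡ xs (pos-< xs i<))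

  private
    below-∷ʳ⁻ : ∀ i {p} → i < a → p < length xs → Below w i (at w p) → Below xs i (at xs p)
    below-∷ʳ⁻ zero    i< p< _ = tt
    below-∷ʳ⁻ (suc i) i< p< b = subst₂ _<_ (at-++ˡ xs p<) (val-∷ʳ (<⇒≤ i<)) b

    below-∷ʳ⁺ : ∀ i {p} → i < a → p < length xs → Below xs i (at xs p) → Below w i (at w p)
    below-∷ʳ⁺ zero    i< p< _ = tt
    below-∷ʳ⁺ (suc i) i< p< b = subst₂ _<_ (sym (at-++ˡ xs p<)) (sym (val-∷ʳ (<⇒≤ i<))) b

    below-last : ∀ i → i < a → Below w i m → i ≡ 0
    below-last zero    _  _ = refl
    below-last (suc i) i< b =
      contradiction (subst (m <_) (val-∷ʳ (<⇒≤ i<)) b) (<-asym (xs<m (val-∈ xs (<⇒≤ i<))))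

    pos-≤-∷ʳ : ∀ {j} → j ≤ a → pos xs j ≤ pos w j
    pos-≤-∷ʳ j≤ with m≤n⇒m<n∨m≡n j≤
    ... | inj₁ j<   = ≤-reflexive (sym (pos-∷ʳ j<))
    ... | inj₂ refl = ≤-trans (pos-≤ xs ≤-refl) (≤-trans (n≤1+n _) (≤-reflexive (sym pos-∷ʳ-end)))

  -- The entry `m` comes after all minima, hence in the last column, and exceeds all of them, hence
  -- in the top row. Only the right end of the last column moves.
  occupied-∷ʳ⁻ : ∀ i j → i ≤ j → j < a → Occupied w i j → Occupied xs i j ⊎ (i ≡ 0 × suc j ≡ a)
  occupied-∷ʳ⁻ i j i≤j j<a (p , p< , j<p , p<j , i<v , b)
    with at-∷ʳ xs p p< | m≤n⇒m<n∨m≡n j<a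
  ... | inj₁ p<xs | j<a⊎ = inj₁ (p , p<xs , subst (_< p) (pos-∷ʳ j<a) j<p , p<pos j<a⊎ ,
    subst₂ _<_ (val-∷ʳ (≤-<-trans i≤j j<a)) (at-++ˡ xs p<xs) i<v , below-∷ʳ⁻ i (≤-<-trans i≤j j<a) p<xs b)
    where
    p<pos : suc j < a ⊎ suc j ≡ a → p < pos xs (suc j)
    p<pos (inj₁ j<)    = subst (p <_) (pos-∷ʳ j<) p<j
    p<pos (inj₂ 1+j≡a) = subst (p <_) (sym (trans (cong (pos xs) 1+j≡a) (pos-end xs))) p<xs
  ... | inj₂ (refl , _) | inj₁ 1+j<a = contradiction
    (<-≤-trans (subst (_ <_) (pos-∷ʳ 1+j<a) p<j) (pos-≤ xs j<a)) (<-irrefl refl)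
  ... | inj₂ (refl , e) | inj₂ 1+j≡a =
    inj₂ (below-last i (≤-<-trans i≤j j<a) (subst (Below w i) e b) , 1+j≡a)

  occupied-∷ʳ⁺ : ∀ i j → i ≤ j → j < a → Occupied xs i j → Occupied w i j
  occupied-∷ʳ⁺ i j i≤j j<a (p , p< , j<p , p<j , i<v , b) =
    p , left-<⁺ xs p< , subst (_< p) (sym (pos-∷ʳ j<a)) j<p , <-≤-trans p<j (pos-≤-∷ʳ j<a) ,
    subst₂ _<_ (sym (val-∷ʳ (≤-<-trans i≤j j<a))) (sym (at-++ˡ xs p<)) i<v ,
    below-∷ʳ⁺ i (≤-<-trans i≤j j<a) p< b

  occupied-∷ʳ-last : ∀ j → suc j ≡ a → Occupied w 0 j
  occupied-∷ʳ-last j 1+j≡a =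
    length xs , ≤-reflexive (sym |w|) ,
    subst (_< length xs) (sym (pos-∷ʳ j<a)) (pos-< xs j<a) ,
    ≤-reflexive (sym (trans (cong (pos w) 1+j≡a) pos-∷ʳ-end)) ,
    subst₂ _<_ (sym (val-∷ʳ 0<a)) (sym at-last) (xs<m (val-∈ xs 0<a)) , tt
    where
    j<a : j < a
    j<a = ≤-reflexive 1+j≡a
    0<a : 0 < a
    0<a = ≤-<-trans z≤n j<a

-- full t holds when the top box of the last column of perm c t is nonzero.
full : Tree → Bool
full leaf                       = false
full (node leaf _)              = false
full (node (node _ _) leaf)     = true
full (node (node _ _) (node _ _)) = false

-- The superscript versions describe `perm c l` with a larger entry appended. Over a leaf that entry
-- is itself a minimum; over a node it adds no minimum.
minima minimaˡ : Tree → ℕ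
minima leaf          = 0
minima (node l r)    = minimaˡ l + minima r
minimaˡ leaf         = 1
minimaˡ l@(node _ _) = minima l

shift : ℕ → ℕ × ℕ → ℕ × ℕ
shift a (i , j) = a + i , a + j

cells cellsˡ : Tree → List (ℕ × ℕ)
cells leaf          = []
cells (node l r)    = cellsˡ l ++ map (shift (minimaˡ l)) (cells r)
cellsˡ leaf         = []
cellsˡ l@(node _ _) = if full l then cells l else (0 , pred (minima l)) ∷ cells l

minima>0 : ∀ l r → 0 < minima (node l r)
minima>0 leaf         r = s≤s z≤n
minima>0 (node l l′)  r = ≤-trans (minima>0 l l′) (m≤m+n _ (minima r))

minimaˡ>0 : ∀ l → 0 < minimaˡ l
minimaˡ>0 leaf       = s≤s z≤n
minimaˡ>0 (node l r) = minima>0 l r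

suc-pred′ : ∀ {n} → 0 < n → suc (pred n) ≡ n
suc-pred′ 0<n = suc-pred _ {{>-nonZero 0<n}}

perm>0 : ∀ c l r → 0 < length (perm c (node l r))
perm>0 c l r = subst (0 <_) (sym (length-perm c (node l r))) (s≤s z≤n)

#min-perm  : ∀ c t → #min (perm c t) ≡ minima t
#min-permˡ : ∀ c l {m} → (∀ {x} → x ∈ perm c l → x < m) → #min (perm c l ++ [ m ]) ≡ minimaˡ l
#min-perm c leaf       = refl
#min-perm c (node l r) = trans (#min-++ (perm (c + size r) l ++ [ top c l r ]) (permˡʳ≫ c l r))
  (cong₂ _+_ (#min-permˡ (c + size r) l (permˡ< c l r)) (#min-perm c r))
#min-permˡ c leaf           _   = refl
#min-permˡ c t@(node l r) t<m =
  trans (#min-∷ʳ (perm c t) (perm>0 c l r) t<m) (#min-perm c t)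

∈-cellsˡ⁻ : ∀ l r {ij} → ij ∈ cellsˡ (node l r) →
             ij ≡ (0 , pred (minima (node l r))) ⊎ ij ∈ cells (node l r)
∈-cellsˡ⁻ l r ij∈ with full (node l r) | ij∈
... | true  | ij∈′       = inj₂ ij∈′
... | false | here eq    = inj₁ eq
... | false | there ij∈′ = inj₂ ij∈′

∈-cellsˡ⁺ : ∀ l r {ij} → ij ∈ cells (node l r) → ij ∈ cellsˡ (node l r)
∈-cellsˡ⁺ l r ij∈ with full (node l r)
... | true  = ij∈
... | false = there ij∈

corner-∈ˡ : ∀ l r → (T (full (node l r)) → (0 , pred (minima (node l r))) ∈ cells (node l r)) →
            (0 , pred (minima (node l r))) ∈ cellsˡ (node l r)
corner-∈ˡ l r c∈ with full (node l r)
... | true  = c∈ _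
... | false = here refl

-- With nothing after the maximum, the corner is either the box added by `cellsˡ` or, when the left
-- subtree is itself full, already present there.
corner-∈ : ∀ t → T (full t) → (0 , pred (minima t)) ∈ cells t
corner-∈ (node l@(node a b) leaf) _ =
  subst₂ (λ n cs → (0 , pred n) ∈ cs) (sym (+-identityʳ (minima l))) (sym (++-identityʳ (cellsˡ l)))
    (corner-∈ˡ a b (corner-∈ l))

cellsˡ-bound : ∀ l → (∀ {i j} → (i , j) ∈ cells l → i ≤ j × j < minima l) →
               ∀ {i j} → (i , j) ∈ cellsˡ l → i ≤ j × j < minimaˡ l
cellsˡ-bound (node l r) ih ij∈ with ∈-cellsˡ⁻ l r ij∈
... | inj₁ refl = z≤n , ≤-reflexive (suc-pred′ (minima>0 l r))
... | inj₂ ij∈′ = ih ij∈′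

cells-bound  : ∀ t {i j} → (i , j) ∈ cells t → i ≤ j × j < minima t
cells-bound (node l r) ij∈ with ∈-++⁻ (cellsˡ l) ij∈
... | inj₁ ij∈l with cellsˡ-bound l (cells-bound l) ij∈l
...   | i≤j , j< = i≤j , ≤-trans j< (m≤m+n (minimaˡ l) (minima r))
cells-bound (node l r) ij∈ | inj₂ ij∈r with ∈-map⁻ (shift (minimaˡ l)) ij∈r
... | (i , j) , ij∈′ , refl with cells-bound r ij∈′
...   | i≤j , j< = +-monoʳ-≤ (minimaˡ l) i≤j , +-monoʳ-< (minimaˡ l) j<

-- With a leaf on the left, all cells are shifted out of row 0. With two nodes, row 0 belongs to the
-- left block and the last column to the right one.
corner-∉ : ∀ t → ¬ T (full t) → (0 , pred (minima t)) ∉ cells t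
corner-∉ (node (node _ _) leaf) ¬full _ = ¬full _
corner-∉ (node leaf r) _ c∈ with ∈-map⁻ (shift 1) c∈
... | _ , _ , ()
corner-∉ (node l@(node _ _) r@(node r₁ r₂)) _ c∈ with ∈-++⁻ (cellsˡ l) c∈
... | inj₁ c∈l = <⇒≱ (proj₂ (cellsˡ-bound l (cells-bound l) c∈l)) (≤-pred (begin
    suc (minima l)                   ≡⟨ +-comm 1 (minima l) ⟩
    minima l + 1                     ≤⟨ +-monoʳ-≤ (minima l) (minima>0 r₁ r₂) ⟩
    minima l + minima r              ≡⟨ suc-pred′ (≤-trans (minimaˡ>0 l) (m≤m+n (minima l) (minima r))) ⟨
    suc (pred (minima l + minima r)) ∎))
  where open ≤-Reasoning
... | inj₂ c∈r with ∈-map⁻ (shift (minima l)) c∈r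
...   | (i , j) , _ , eq = <⇒≢ (≤-trans (minimaˡ>0 l) (m≤m+n (minima l) i)) (cong proj₁ eq)

shift-injective : ∀ a {b b′} → shift a b ≡ shift a b′ → b ≡ b′
shift-injective a eq = cong₂ _,_ (+-cancelˡ-≡ a _ _ (cong proj₁ eq)) (+-cancelˡ-≡ a _ _ (cong proj₂ eq))

cellsˡ-unique : ∀ l → Unique (cells l) → Unique (cellsˡ l)
cellsˡ-unique leaf         _ = []
cellsˡ-unique t@(node _ _) t! with full t in eq
... | true  = t!
... | false = tabulate (λ { c∈ refl → corner-∉ t (subst T eq) c∈ }) ∷ t!

cells-unique  : ∀ t → Unique (cells t)
cells-unique leaf       = []
cells-unique (node l r) = Unique.++⁺ (cellsˡ-unique l (cells-unique l))
  (Unique.map⁺ (shift-injective (minimaˡ l)) (cells-unique r)) disjoint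
  where
  disjoint : Disjoint (cellsˡ l) (map (shift (minimaˡ l)) (cells r))
  disjoint (p , q) with ∈-map⁻ (shift (minimaˡ l)) q
  ... | (i , j) , _ , refl = m+n≮m (minimaˡ l) j (proj₂ (cellsˡ-bound l (cells-bound l) p))

occupied⇒∈cellsˡ : ∀ c l {m} → (∀ {x} → x ∈ perm c l → x < m) →
  (∀ {i j} → i ≤ j → j < minima l → Occupied (perm c l) i j → (i , j) ∈ cells l) →
  ∀ {i j} → i ≤ j → j < minimaˡ l → Occupied (perm c l ++ [ m ]) i j → (i , j) ∈ cellsˡ l
occupied⇒∈cellsˡ c leaf         _   _  _   (s≤s z≤n) (zero , _ , () , _)
occupied⇒∈cellsˡ c leaf         _   _  _   (s≤s z≤n) (suc p , s≤s () , _)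
occupied⇒∈cellsˡ c t@(node l r) t<m ih {i} {j} i≤j j< occ
  with occupied-∷ʳ⁻ (perm c t) (perm>0 c l r) t<m i j i≤j (subst (j <_) (sym (#min-perm c t)) j<) occ
... | inj₁ occ′          = ∈-cellsˡ⁺ l r (ih i≤j j< occ′)
... | inj₂ (refl , 1+j≡) with refl ← cong pred (trans 1+j≡ (#min-perm c t)) = corner-∈ˡ l r (corner-∈ t)

occupied⇒∈cells : ∀ c t {i j} → i ≤ j → j < minima t → Occupied (perm c t) i j → (i , j) ∈ cells t
occupied⇒∈cells c (node l r) {i} {j} i≤j j< occ
  with occupied-++⁻ (perm (c + size r) l ++ [ top c l r ]) (permˡʳ≫ c l r) i j i≤j occ
     | #min-permˡ (c + size r) l (permˡ< c l r)
... | inj₁ (j<a , occˡ) | #min≡ = ∈-++⁺ˡ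
  (occupied⇒∈cellsˡ (c + size r) l (permˡ< c l r) (occupied⇒∈cells (c + size r) l) i≤j (subst (j <_) #min≡ j<a) occˡ)
... | inj₂ (i′ , j′ , refl , refl , occʳ) | #min≡ rewrite #min≡ =
  ∈-++⁺ʳ (cellsˡ l) (∈-map⁺ (shift (minimaˡ l))
    (occupied⇒∈cells c r (+-cancelˡ-≤ (minimaˡ l) _ _ i≤j) (+-cancelˡ-< (minimaˡ l) _ _ j<) occʳ))

∈cellsˡ⇒occupied : ∀ c l {m} → (∀ {x} → x ∈ perm c l → x < m) →
  (∀ {i j} → (i , j) ∈ cells l → Occupied (perm c l) i j) →
  ∀ {i j} → (i , j) ∈ cellsˡ l → Occupied (perm c l ++ [ m ]) i j
∈cellsˡ⇒occupied c t@(node l r) t<m ih {i} {j} ij∈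
  with ∈-cellsˡ⁻ l r ij∈ | cellsˡ-bound t (cells-bound t) ij∈
... | inj₁ refl | _        = occupied-∷ʳ-last (perm c t) (perm>0 c l r) t<m j
  (trans (suc-pred′ (minima>0 l r)) (sym (#min-perm c t)))
... | inj₂ ij∈′ | i≤j , j< = occupied-∷ʳ⁺ (perm c t) (perm>0 c l r) t<m i j i≤j
  (subst (j <_) (sym (#min-perm c t)) j<) (ih ij∈′)

∈cells⇒occupied : ∀ c t {i j} → (i , j) ∈ cells t → Occupied (perm c t) i j
∈cells⇒occupied c (node l r) {i} {j} ij∈ with ∈-++⁻ (cellsˡ l) ij∈
... | inj₁ ij∈l with cellsˡ-bound l (cells-bound l) ij∈l
...   | i≤j , j< = occupied-++⁺ˡ (perm (c + size r) l ++ [ top c l r ]) (permˡʳ≫ c l r) i j i≤j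
  (subst (j <_) (sym (#min-permˡ (c + size r) l (permˡ< c l r))) j<)
  (∈cellsˡ⇒occupied (c + size r) l (permˡ< c l r) (∈cells⇒occupied (c + size r) l) ij∈l)
∈cells⇒occupied c (node l r) ij∈ | inj₂ ij∈r with ∈-map⁻ (shift (minimaˡ l)) ij∈r
... | (i , j) , ij∈′ , refl = subst (λ a → Occupied (perm c (node l r)) (a + i) (a + j))
  (#min-permˡ (c + size r) l (permˡ< c l r))
  (occupied-++⁺ʳ (perm (c + size r) l ++ [ top c l r ]) (permˡʳ≫ c l r) i j (∈cells⇒occupied c r ij∈′))

-- From occupied boxes to `nonzeroBoxes`

inBox : List ℕ → ℕ → ℕ → ℕ → Bool
inBox w i j p = (kPos w j <ᵇ p) ∧ (p <ᵇ kPos w (suc j)) ∧ (kVal w i <ᵇ at w p) ∧ (at w p <ᵇ kVal w (pred i))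

module _ (w : List ℕ) (w≤ : ∀ {x} → x ∈ w → x ≤ length w) where

  box⇒occupied : ∀ i j → T (0 <ᵇ box w (suc i) (suc j)) → Occupied w i j
  box⇒occupied i j t with nonempty (<ᵇ⇒< 0 _ t)
    where
    nonempty : ∀ {A : Set} {xs : List A} → 0 < length xs → ∃[ x ] x ∈ xs
    nonempty {xs = x ∷ _} _ = x , here refl
  ... | p , p∈ with ∈-filter⁻ (λ p → T? (inBox w (suc i) (suc j) p)) {xs = upTo (length w)} p∈
  ...   | p∈′ , t₁ =
    let a , t₂ = T-∧⁻ {pos w j <ᵇ p} t₁
        b , t₃ = T-∧⁻ {p <ᵇ pos w (suc j)} t₂
        c , d = T-∧⁻ {val w i <ᵇ at w p} t₃
    in p , ∈-upTo⁻ p∈′ , <ᵇ⇒< _ _ a , <ᵇ⇒< _ _ b , <ᵇ⇒< _ _ c , below i d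
    where
    below : ∀ i → T (at w p <ᵇ kVal w i) → Below w i (at w p)
    below zero    _ = tt
    below (suc i) t = <ᵇ⇒< _ _ t

  occupied⇒box : ∀ i j → Occupied w i j → T (0 <ᵇ box w (suc i) (suc j))
  occupied⇒box i j (p , p< , a , b , c , d) = <⇒<ᵇ (∈-length
    (∈-filter⁺ (λ p → T? (inBox w (suc i) (suc j) p)) (∈-upTo⁺ p<)
      (T-∧⁺ (<⇒<ᵇ a) (T-∧⁺ (<⇒<ᵇ b) (T-∧⁺ (<⇒<ᵇ c) (below i d))))))
    where
    below : ∀ i → Below w i (at w p) → T (at w p <ᵇ kVal w i)
    -- In the top row the upper bound is `suc (length w)`, so `w≤` supplies what `Below` does not
    -- record.
    below zero    _ = <⇒<ᵇ (s≤s (w≤ (at-∈ p<)))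
    below (suc i) b = <⇒<ᵇ b

∈-boxes⁺ : ∀ {a i j} → i ≤ j → j < a → (suc i , suc j) ∈ boxes a
∈-boxes⁺ i≤j j<a = ∈-concatMap⁺ (λ j → map (λ i → (suc i , suc j)) (upTo (suc j)))
  (lose (∈-upTo⁺ j<a) (∈-map⁺ _ (∈-upTo⁺ (s≤s i≤j))))

∈-boxes⁻ : ∀ a {b} → b ∈ boxes a → ∃[ i ] ∃[ j ] i ≤ j × j < a × b ≡ (suc i , suc j)
∈-boxes⁻ a b∈ with find (∈-concatMap⁻ (λ j → map (λ i → (suc i , suc j)) (upTo (suc j))) {xs = upTo a} b∈)
... | j , j∈ , b∈′ with ∈-map⁻ (λ i → (suc i , suc j)) b∈′
...   | i , i∈ , refl = i , j , ≤-pred (∈-upTo⁻ i∈) , ∈-upTo⁻ j∈ , refl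

boxes-unique : ∀ a → Unique (boxes a)
boxes-unique a = Unique.concat⁺
  (All.map⁺ (tabulate λ _ → Unique.map⁺ (suc-injective ∘ cong proj₁) (Unique.upTo⁺ _)))
  (AllPairs.map⁺ (AllPairs.map disjoint (Unique.upTo⁺ a)))
  where
  column : ℕ → List (ℕ × ℕ)
  column j = map (λ i → (suc i , suc j)) (upTo (suc j))
  disjoint : ∀ {j k} → j ≢ k → Disjoint (column j) (column k)
  disjoint j≢k (p , q) with ∈-map⁻ _ p | ∈-map⁻ _ q
  ... | _ , _ , refl | _ , _ , eq = j≢k (suc-injective (cong proj₂ eq))

-- `boxes` runs through columns and `cells` through the tree, so they are compared as sets. The
-- shift by 1 passes from indices starting at 0 to those starting at 1.
nonzeroBoxes-perm : ∀ t → nonzeroBoxes (perm 0 t) ≡ length (cells t)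
nonzeroBoxes-perm t = trans
  (length-≡-⊆⊇ (Unique.filter⁺ P? (boxes-unique (#min w)))
    (Unique.map⁺ (shift-injective 1) (cells-unique t)) nonzero⊆cells cells⊆nonzero)
  (length-map (shift 1) (cells t))
  where
  w = perm 0 t
  P? = λ b → T? (0 <ᵇ box w (proj₁ b) (proj₂ b))
  w≤ : ∀ {x} → x ∈ w → x ≤ length w
  w≤ x∈ = ≤-trans (proj₂ (perm-range 0 t x∈)) (≤-reflexive (sym (length-perm 0 t)))
  nonzero⊆cells : filter P? (boxes (#min w)) ⊆ map (shift 1) (cells t)
  nonzero⊆cells b∈ with ∈-filter⁻ P? {xs = boxes (#min w)} b∈
  ... | b∈′ , nz with ∈-boxes⁻ (#min w) b∈′
  ...   | i , j , i≤j , j< , refl = ∈-map⁺ (shift 1)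
    (occupied⇒∈cells 0 t i≤j (subst (j <_) (#min-perm 0 t) j<) (box⇒occupied w w≤ i j nz))
  cells⊆nonzero : map (shift 1) (cells t) ⊆ filter P? (boxes (#min w))
  cells⊆nonzero b∈ with ∈-map⁻ (shift 1) b∈
  ... | (i , j) , ij∈ , refl with cells-bound t ij∈
  ...   | i≤j , j< = ∈-filter⁺ P? (∈-boxes⁺ i≤j (subst (j <_) (sym (#min-perm 0 t)) j<))
    (occupied⇒box w w≤ i j (∈cells⇒occupied 0 t ij∈))

-- Permutations attaining both bounds

#cells : Tree → ℕ
#cells t = length (cells t)

#cells-node : ∀ l r → #cells (node l r) ≡ length (cellsˡ l) + #cells r
#cells-node l r = trans (length-++ (cellsˡ l)) (cong (length (cellsˡ l) +_) (length-map (shift (minimaˡ l)) (cells r)))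

#cellsˡ-full : ∀ l r → full (node l r) ≡ true → length (cellsˡ (node l r)) ≡ #cells (node l r)
#cellsˡ-full l r eq rewrite eq = refl

#cellsˡ-¬full : ∀ l r → full (node l r) ≡ false → length (cellsˡ (node l r)) ≡ suc (#cells (node l r))
#cellsˡ-¬full l r eq rewrite eq = refl

-- These are the equality cases of both bounds: `tight` for trees that are not full, `tightTop` for
-- full ones. Their sizes are three times the size of the argument, plus 1 and plus 2.
tight tightTop : Tree → Tree
tight leaf       = node leaf leaf
tight (node u v) = node (tight u) (tightTop v)
tightTop u = node (tight u) leaf

-- d₁ and d₂ are the defects in k + a ≤ s and k + 1 + e ≤ 2a, where the second
-- bound has e = 0 for full trees and e = 1 for the other nonempty ones.
record Slack (t : Tree) (e : ℕ) (shape : Tree → Tree) : Set where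
  constructor slack
  field
    d₁ d₂     : ℕ
    size≡     : #cells t + minima t + d₁ ≡ size t
    minima≡   : #cells t + suc e + d₂ ≡ 2 * minima t
    no-slack⇒ : d₁ ≡ 0 → d₂ ≡ 0 → ∃[ u ] t ≡ shape u

SlackOf : Tree → Set
SlackOf t = (full t ≡ true × Slack t 0 tightTop) ⊎ (full t ≡ false × Slack t 1 tight)

private
  size-leaf : ∀ k a d → k + suc a + d ≡ suc (k + a + d)
  size-leaf = solve-∀
  minima-leaf : ∀ k e d → k + 2 + (suc e + d) ≡ 2 + (k + suc e + d)
  minima-leaf = solve-∀
  2*suc : ∀ a → 2 + 2 * a ≡ 2 * suc a
  2*suc = solve-∀

-- The root is a new minimum that fills no box. The first bound keeps its defect, while 2a grows by
-- 2 and makes the second bound strict.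
slack-leaf-node : ∀ r {e shape} → Slack r e shape → Slack (node leaf r) 1 tight
slack-leaf-node r {e} (slack d₁ d₂ s≡ m≡ _)  = slack d₁ (suc e + d₂)
  (trans (cong (λ k → k + suc (minima r) + d₁) (length-map (shift 1) (cells r)))
    (trans (size-leaf (#cells r) (minima r) d₁) (cong suc s≡)))
  (trans (cong (λ k → k + 2 + (suc e + d₂)) (length-map (shift 1) (cells r)))
    (trans (minima-leaf (#cells r) e d₂) (trans (cong (2 +_) m≡) (2*suc (minima r)))))
  λ _ ()

-- Over a full left subtree the root adds to the size only, which makes the first bound strict. Over
-- any other the root adds a box, paid for by `e` dropping from 1 to 0, and no defect arises.
slack-node-leaf : ∀ l r → SlackOf (node l r) → Slack (node (node l r) leaf) 0 tightTop
slack-node-leaf l r (inj₁ (f , slack d₁ d₂ s≡ m≡ _)) = slack (suc d₁) d₂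
  (trans (cong₂ (λ k a → k + a + suc d₁) k≡ (+-identityʳ _))
    (trans (+-suc _ d₁) (cong suc (trans s≡ (sym (+-identityʳ _))))))
  (trans (cong (λ k → k + 1 + d₂) k≡) (trans m≡ (cong (2 *_) (sym (+-identityʳ (minima (node l r)))))))
  λ ()
  where
  k≡ : #cells (node (node l r) leaf) ≡ #cells (node l r)
  k≡ = trans (#cells-node (node l r) leaf) (trans (+-identityʳ _) (#cellsˡ-full l r f))
slack-node-leaf l r (inj₂ (f , slack d₁ d₂ s≡ m≡ shape)) = slack d₁ d₂
  (trans (cong₂ (λ k a → k + a + d₁) k≡ (+-identityʳ _)) (cong suc (trans s≡ (sym (+-identityʳ _)))))
  (trans (cong (λ k → k + 1 + d₂) k≡) 
    (trans (e₁ (#cells (node l r)) d₂) (trans m≡ (cong (2 *_) (sym (+-identityʳ (minima (node l r))))))))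
  λ d₁≡ d₂≡ → let u , eq = shape d₁≡ d₂≡ in u , cong (λ t → node t leaf) eq
  where
  k≡ : #cells (node (node l r) leaf) ≡ suc (#cells (node l r))
  k≡ = trans (#cells-node (node l r) leaf) (trans (+-identityʳ _) (#cellsˡ-¬full l r f))
  e₁ : ∀ k d → suc k + 1 + d ≡ k + 2 + d
  e₁ = solve-∀

-- The root contributes neither a box nor a minimum, so the first bound is strict.
slack-full-node : ∀ l r r′ {e shape} → full (node l r) ≡ true → Slack (node l r) 0 tightTop →
                  Slack r′ e shape → Slack (node (node l r) r′) 1 tight
slack-full-node l r r′ {e} f (slack d₁ d₂ s≡ m≡ _) (slack d₁′ d₂′ s≡′ m≡′ _) =
  slack (suc (d₁ + d₁′)) (d₂ + d₂′ + e)
  (trans (cong (λ k → k + (minima (node l r) + minima r′) + suc (d₁ + d₁′)) k≡)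
    (trans (e₁ (#cells (node l r)) (#cells r′) (minima (node l r)) (minima r′) d₁ d₁′) (cong suc (cong₂ _+_ s≡ s≡′))))
  (trans (cong (λ k → k + 2 + (d₂ + d₂′ + e)) k≡)
    (trans (e₂ (#cells (node l r)) (#cells r′) d₂ d₂′ e)
      (trans (cong₂ _+_ m≡ m≡′) (sym (*-distribˡ-+ 2 (minima (node l r)) (minima r′))))))
  λ ()
  where
  k≡ : #cells (node (node l r) r′) ≡ #cells (node l r) + #cells r′
  k≡ = trans (#cells-node (node l r) r′) (cong (_+ #cells r′) (#cellsˡ-full l r f))
  e₁ : ∀ k k′ a a′ d d′ → (k + k′) + (a + a′) + suc (d + d′) ≡ suc ((k + a + d) + (k′ + a′ + d′))
  e₁ = solve-∀
  e₂ : ∀ k k′ d d′ e → (k + k′) + 2 + (d + d′ + e) ≡ (k + 1 + d) + (k′ + suc e + d′)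
  e₂ = solve-∀

-- The new box balances the root in the first bound. In the second, the `e` of the right subtree
-- becomes slack, so equality forces that subtree to be full; `top` then identifies its shape.
slack-¬full-node : ∀ l r r′ {e shape} → full (node l r) ≡ false → Slack (node l r) 1 tight →
                   Slack r′ e shape → (e ≡ 0 → ∀ u → shape u ≡ tightTop u) → Slack (node (node l r) r′) 1 tight
slack-¬full-node l r r′ {e} f (slack d₁ d₂ s≡ m≡ shape) (slack d₁′ d₂′ s≡′ m≡′ shape′) top =
  slack (d₁ + d₁′) (d₂ + d₂′ + e)
  (trans (cong (λ k → k + (minima (node l r) + minima r′) + (d₁ + d₁′)) k≡)
    (trans (e₁ (#cells (node l r)) (#cells r′) (minima (node l r)) (minima r′) d₁ d₁′) (cong suc (cong₂ _+_ s≡ s≡′))))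
  (trans (cong (λ k → k + 2 + (d₂ + d₂′ + e)) k≡)
    (trans (e₂ (#cells (node l r)) (#cells r′) d₂ d₂′ e)
      (trans (cong₂ _+_ m≡ m≡′) (sym (*-distribˡ-+ 2 (minima (node l r)) (minima r′))))))
  λ d₁≡ d₂≡ →
    let u , eq  = shape (m+n≡0⇒m≡0 d₁ d₁≡) (m+n≡0⇒m≡0 d₂ (m+n≡0⇒m≡0 (d₂ + d₂′) d₂≡))
        v , eq′ = shape′ (m+n≡0⇒n≡0 d₁ d₁≡) (m+n≡0⇒n≡0 d₂ (m+n≡0⇒m≡0 (d₂ + d₂′) d₂≡))
    in node u v , cong₂ node eq (trans eq′ (top (m+n≡0⇒n≡0 (d₂ + d₂′) d₂≡) v))
  where
  k≡ : #cells (node (node l r) r′) ≡ suc (#cells (node l r) + #cells r′)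
  k≡ = trans (#cells-node (node l r) r′) (cong (_+ #cells r′) (#cellsˡ-¬full l r f))
  e₁ : ∀ k k′ a a′ d d′ → suc (k + k′) + (a + a′) + (d + d′) ≡ suc ((k + a + d) + (k′ + a′ + d′))
  e₁ = solve-∀
  e₂ : ∀ k k′ d d′ e → suc (k + k′) + 2 + (d + d′ + e) ≡ (k + 2 + d) + (k′ + suc e + d′)
  e₂ = solve-∀

slackOf : ∀ l r → SlackOf (node l r)
slackOf leaf leaf = inj₂ (refl , slack 0 0 refl refl λ _ _ → leaf , refl)
slackOf leaf r@(node r₁ r₂) with slackOf r₁ r₂
... | inj₁ (_ , s) = inj₂ (refl , slack-leaf-node r s)
... | inj₂ (_ , s) = inj₂ (refl , slack-leaf-node r s)
slackOf (node l₁ l₂) leaf = inj₁ (refl , slack-node-leaf l₁ l₂ (slackOf l₁ l₂))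
slackOf (node l₁ l₂) r@(node r₁ r₂) with slackOf l₁ l₂ | slackOf r₁ r₂
... | inj₁ (f , s) | inj₁ (_ , s′) = inj₂ (refl , slack-full-node l₁ l₂ r f s s′)
... | inj₁ (f , s) | inj₂ (_ , s′) = inj₂ (refl , slack-full-node l₁ l₂ r f s s′)
... | inj₂ (f , s) | inj₁ (_ , s′) = inj₂ (refl , slack-¬full-node l₁ l₂ r f s s′ λ _ _ → refl)
... | inj₂ (f , s) | inj₂ (_ , s′) = inj₂ (refl , slack-¬full-node l₁ l₂ r f s s′ λ ())

size-tight : ∀ u → size (tight u) ≡ suc (3 * size u)
size-tight leaf       = refl
size-tight (node u v) rewrite size-tight u | size-tight v = e (size u) (size v)
  where
  e : ∀ a b → suc (suc (3 * a) + suc (suc (3 * b) + 0)) ≡ suc (3 * suc (a + b))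
  e = solve-∀

size-tightTop : ∀ u → size (tightTop u) ≡ 3 * size u + 2
size-tightTop u rewrite size-tight u = e (size u)
  where
  e : ∀ a → suc (suc (3 * a) + 0) ≡ 3 * a + 2
  e = solve-∀

-- `tight u` is never full: its left subtree is a leaf or its right subtree is a node.
#cellsˡ-tight : ∀ u → length (cellsˡ (tight u)) ≡ suc (#cells (tight u))
#cellsˡ-tight leaf                  = refl
#cellsˡ-tight (node leaf v)         = refl
#cellsˡ-tight (node (node _ _) v)   = refl

#cells-tightTop : ∀ u → #cells (tightTop u) ≡ suc (#cells (tight u))
#cells-tightTop u = trans (#cells-node (tight u) leaf) (trans (+-identityʳ _) (#cellsˡ-tight u))

#cells-tight : ∀ u → #cells (tight u) ≡ 2 * size u
#cells-tight leaf       = refl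
#cells-tight (node u v) = trans (#cells-node (tight u) (tightTop v))
  (trans (cong₂ _+_ (trans (#cellsˡ-tight u) (cong suc (#cells-tight u)))
                    (trans (#cells-tightTop v) (cong suc (#cells-tight v))))
    (e (size u) (size v)))
  where
  e : ∀ a b → suc (2 * a) + suc (2 * b) ≡ 2 * suc (a + b)
  e = solve-∀

tight-injective : ∀ {u v} → tight u ≡ tight v → u ≡ v
tight-injective {leaf}              {leaf}              _  = refl
tight-injective {leaf}              {node leaf _}       ()
tight-injective {leaf}              {node (node _ _) _} ()
tight-injective {node leaf _}       {leaf}              ()
tight-injective {node (node _ _) _} {leaf}              ()
tight-injective {node u v}          {node u′ v′}        eq =
  cong₂ node (tight-injective (cong left-child eq)) (tight-injective (cong (left-child ∘ right-child) eq))
  where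
  left-child right-child : Tree → Tree
  left-child leaf       = leaf
  left-child (node l _) = l
  right-child leaf       = leaf
  right-child (node _ r) = r

tightTop-complete : ∀ i t → size t ≡ 3 * i + 2 → #cells t ≡ 2 * i + 1 → ∃[ u ] size u ≡ i × t ≡ tightTop u
tightTop-complete i leaf         s≡ _ = contradiction (trans s≡ (+-comm (3 * i) 2)) λ ()
tightTop-complete i t@(node l r) s≡ k≡ = go (slackOf l r)
  where
  no-slack : ∀ {e shape} (s : Slack t e shape) → e + Slack.d₂ s + 2 * Slack.d₁ s ≡ 0
  no-slack {e} (slack d₁ d₂ size≡ minima≡ _) = +-cancelˡ-≡ (6 * i + 4) _ _ (begin
    6 * i + 4 + (e + d₂ + 2 * d₁)                          ≡⟨ e₁ i e d₂ d₁ ⟩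
    2 * k + (k + suc e + d₂) + 2 * d₁                      ≡⟨ cong (λ x → 2 * k + x + 2 * d₁) minima≡′ ⟩
    2 * k + 2 * minima t + 2 * d₁                          ≡⟨ e₂ k (minima t) d₁ ⟩
    2 * (k + minima t + d₁)                                ≡⟨ cong (2 *_) (trans size≡′ s≡) ⟩
    2 * (3 * i + 2)                                        ≡⟨ e₃ i ⟩
    6 * i + 4 + 0                                          ∎)
    where
    open ≡-Reasoning
    k = 2 * i + 1
    size≡′ : k + minima t + d₁ ≡ size t
    size≡′ = subst (λ k → k + minima t + d₁ ≡ size t) k≡ size≡
    minima≡′ : k + suc e + d₂ ≡ 2 * minima t
    minima≡′ = subst (λ k → k + suc e + d₂ ≡ 2 * minima t) k≡ minima≡
    e₁ : ∀ i e d₂ d₁ → 6 * i + 4 + (e + d₂ + 2 * d₁) ≡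
         2 * (2 * i + 1) + (2 * i + 1 + suc e + d₂) + 2 * d₁
    e₁ = solve-∀
    e₂ : ∀ k m d → 2 * k + 2 * m + 2 * d ≡ 2 * (k + m + d)
    e₂ = solve-∀
    e₃ : ∀ i → 2 * (3 * i + 2) ≡ 6 * i + 4 + 0
    e₃ = solve-∀
  go : SlackOf t → ∃[ u ] size u ≡ i × t ≡ tightTop u
  go (inj₂ (_ , s)) = contradiction (no-slack s) λ ()
  go (inj₁ (_ , s)) =
    let d₂≡ = m+n≡0⇒m≡0 (Slack.d₂ s) (no-slack s)
        d₁≡ = m+n≡0⇒m≡0 (Slack.d₁ s) (m+n≡0⇒n≡0 (Slack.d₂ s) (no-slack s))
        u , eq = Slack.no-slack⇒ s d₁≡ d₂≡
    in u , *-cancelˡ-≡ _ _ 3 (+-cancelʳ-≡ 2 _ _ (trans (sym (size-tightTop u)) (trans (cong size (sym eq)) s≡))) , eq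

tightPerm : Vec Tree 1 → List ℕ
tightPerm (u ∷ []) = perm 0 (tightTop u)

tightPerm-injective : ∀ {us vs} → tightPerm us ≡ tightPerm vs → us ≡ vs
tightPerm-injective {u ∷ []} {v ∷ []} eq
  with tight-injective {u} {v} (cong (λ { leaf → leaf ; (node l _) → l }) (perm-injective 0 (tightTop u) (tightTop v) eq))
... | refl = refl

J≡catalan : ∀ i → J (3 * i + 2) (2 * i + 1) ≡ catalan i
J≡catalan i = trans
  (length-≡-⊆⊇ (Unique.filter⁺ P? (perms-unique (3 * i + 2)))
    (Unique.map⁺ tightPerm-injective (forests-unique 1 i)) counted⊆tight tight⊆counted)
  (trans (length-map tightPerm (forests 1 i)) (length-forests-1 i))
  where
  P? = λ π → T? (avoids132 π ∧ (nonzeroBoxes π ≡ᵇ 2 * i + 1))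
  counted⊆tight : filter P? (perms (3 * i + 2)) ⊆ map tightPerm (forests 1 i)
  counted⊆tight {w} w∈ with ∈-filter⁻ P? {xs = perms (3 * i + 2)} w∈
  ... | w∈′ , pw with ∈-perms⁻ (3 * i + 2) w∈′ | T-∧⁻ {avoids132 w} pw
  ...   | |w|≡ , range , w! | av , nz
    with perm-complete (length w) 0 w ≤-refl w! (λ x∈ → subst (λ n → _ < _ × _ ≤ n) (sym |w|≡) (range x∈)) (avoids132⁻ w av)
  ...     | t , refl with tightTop-complete i t (trans (sym (length-perm 0 t)) |w|≡)
                            (trans (sym (nonzeroBoxes-perm t)) (≡ᵇ⇒≡ _ _ nz))
  ...       | u , |u|≡ , refl = ∈-map⁺ tightPerm (∈-forests⁺ 1 i (u ∷ []) (trans (+-identityʳ _) |u|≡))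
  tight⊆counted : map tightPerm (forests 1 i) ⊆ filter P? (perms (3 * i + 2))
  tight⊆counted w∈ with ∈-map⁻ tightPerm w∈
  ... | u ∷ [] , u∈ , refl = ∈-filter⁺ P? (subst (λ n → w ∈ perms n) |w|≡
      (∈-perms⁺ w (λ x∈ → subst (λ n → _ < _ × _ ≤ n) (sym (length-perm 0 t)) (perm-range 0 t x∈)) (perm-unique 0 t)))
      (T-∧⁺ (avoids132⁺ w (perm-avoids 0 t)) (≡⇒≡ᵇ _ _ nz))
    where
    t = tightTop u
    w = perm 0 t
    |u|≡ : size u ≡ i
    |u|≡ = trans (sym (+-identityʳ _)) (∈-forests⁻ 1 i u∈)
    |w|≡ : length w ≡ 3 * i + 2
    |w|≡ = trans (length-perm 0 t) (trans (size-tightTop u) (cong (λ n → 3 * n + 2) |u|≡))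
    nz : nonzeroBoxes w ≡ 2 * i + 1
    nz = trans (nonzeroBoxes-perm t) (trans (#cells-tightTop u)
      (trans (cong suc (trans (#cells-tight u) (cong (2 *_) |u|≡))) (+-comm 1 (2 * i))))

catalan>0 : ∀ i → 0 < catalan i
catalan>0 i = subst (0 <_) (length-forests-1 i)
  (∈-length (∈-forests⁺ 1 i (comb i ∷ []) (trans (+-identityʳ _) (size-comb i))))
  where
  comb : ℕ → Tree
  comb zero    = leaf
  comb (suc i) = node leaf (comb i)
  size-comb : ∀ i → size (comb i) ≡ i
  size-comb zero    = refl
  size-comb (suc i) = cong suc (size-comb i)

theorem2p8 : (i : ℕ) → 0 < J (3 * i + 2) (2 * i + 1) × J (3 * i + 2) (2 * i + 1) ≡ catalan i
theorem2p8 i = subst (0 <_) (sym (J≡catalan i)) (catalan>0 i) , J≡catalan i
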